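{- For all integers $k > \ell > 1$, no $\alpha \in [0,1)$ is a $\pi_{\ell}^k$-jump; that is, for every $\alpha \in [0,1)$ and every $\delta > 0$ there exists a family $\mathcal{F}$ of $k$-graphs with $\pi_{\ell}(\mathcal{F}) \in (\alpha, \alpha+\delta)$. In particular, the set $\Pi_{\ell}^k = \{ \pi_{\ell}(\mathcal{F}) : \mathcal{F} \text{ is a family of } k\text{ -graphs} \}$ is dense in $[0,1)$.
   Context: A $k$-graph $H$ is a pair $(V(H),E(H))$ where $V(H)$ is a finite set and $E(H)$ is a set of $k$-subsets of $V(H)$. For $0\le \ell<k$ and an $\ell$-subset $T$ of $V(H)$, $\deg^H(T)$ is the number of $(k-\ell)$-subsets $S$ of $V(H)$ with $S\cup T\in E(H)$, and $\delta_\ell(H)=\min\{\deg^H(T): T\subseteq V(H), |T|=\ell\}$. For a (possibly infinite) family $\mathcal{F}$ of $k$-graphs, a $k$-graph is $\mathcal{F}$-free if it contains no copy of any member of $\mathcal{F}$ as a (not necessarily induced) subgraph. Let $\mathrm{ex}_\ell(n,\mathcal{F})$ be the maximum of $\delta_\ell(H)$ over all $\mathcal{F}$-free $k$-graphs $H$ on $n$ vertices (taken to be $0$ if there are none), and let $\pi_\ell(\mathcal{F})=\limsup_{n\to\infty}\mathrm{ex}_\ell(n,\mathcal{F})/\binom{n}{k-\ell}$. A constant $\alpha\in[0,1)$ is a $\pi_\ell^k$-jump if there exists $\delta>0$ such that no family $\mathcal{F}$ of $k$-graphs satisfies $\pi_\ell(\mathcal{F})\in(\alpha,\alpha+\delta)$.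 -}

module Defs where

open import Data.Bool using (Bool; T; _∧_)
open import Data.Fin using (Fin)
open import Data.Fin.Subset using (Subset; inside; outside; ⁅_⁆; ⋃; _∪_; ∣_∣)
open import Data.Fin.Subset.Properties using (_∈?_)
open import Data.Integer as ℤ using ()
open import Data.List using (List; []; _∷_; _++_; map; filter; filterᵇ; length; allFin)
open import Data.List.Extrema.Nat using (min)
open import Data.Nat as ℕ using (ℕ; zero; suc; _∸_; _≡ᵇ_; _⊔_)
import Data.Nat.Properties as ℕₚ
open import Data.Nat.Combinatorics using (_C_)
open import Data.Product using (Σ; ∃; _×_; _,_)
open import Data.Rational as ℚ using (ℚ; 0ℚ; 1ℚ; ½)
import Data.Rational.Properties as ℚₚ
open import Data.Sum using (_⊎_)
open import Data.Vec using ([]; _∷_)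
open import Function using (_∘_)
open import Function.Definitions using (Injective)
open import Relation.Binary.PropositionalEquality
open import Relation.Nullary using (¬_)

-- Real numbers, as Cauchy sequences of rationals.  Two sequences represent
-- the same real when neither is _<ʳ_ the other; every notion below that
-- mentions a real is invariant under this equivalence.

record ℝ : Set where
  constructor mkℝ
  field
    seq    : ℕ → ℚ
    cauchy : ∀ ε → 0ℚ ℚ.< ε →
             ∃ λ N → ∀ m n → N ℕ.≤ m → N ℕ.≤ n →
             ℚ.∣ seq m ℚ.- seq n ∣ ℚ.< ε

open ℝ public

infix  4 _<ʳ_ _≤ʳ_
infixl 6 _+ʳ_

fromℚ : ℚ → ℝ
fromℚ q = mkℝ (λ _ → q) λ ε 0<ε → 0 , λ _ _ _ _ →
  subst (ℚ._< ε) (sym (cong ℚ.∣_∣ (ℚₚ.+-inverseʳ q))) 0<ε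

0ʳ 1ʳ : ℝ
0ʳ = fromℚ 0ℚ
1ʳ = fromℚ 1ℚ

_<ʳ_ : ℝ → ℝ → Set
x <ʳ y = ∃ λ ε → 0ℚ ℚ.< ε × ∃ λ N → ∀ n → N ℕ.≤ n → seq x n ℚ.+ ε ℚ.≤ seq y n

_≤ʳ_ : ℝ → ℝ → Set
x ≤ʳ y = ¬ (y <ʳ x)

private
  interchange : ∀ a b c d →
    (a ℚ.+ b) ℚ.- (c ℚ.+ d) ≡ (a ℚ.- c) ℚ.+ (b ℚ.- d)
  interchange a b c d = begin
    (a ℚ.+ b) ℚ.- (c ℚ.+ d)
      ≡⟨ cong ((a ℚ.+ b) ℚ.+_) (ℚₚ.neg-distrib-+ c d) ⟩
    (a ℚ.+ b) ℚ.+ (ℚ.- c ℚ.+ ℚ.- d)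
      ≡⟨ ℚₚ.+-assoc a b _ ⟩
    a ℚ.+ (b ℚ.+ (ℚ.- c ℚ.+ ℚ.- d))
      ≡⟨ cong (a ℚ.+_) (sym (ℚₚ.+-assoc b (ℚ.- c) (ℚ.- d))) ⟩
    a ℚ.+ ((b ℚ.+ ℚ.- c) ℚ.+ ℚ.- d)
      ≡⟨ cong (λ z → a ℚ.+ (z ℚ.+ ℚ.- d)) (ℚₚ.+-comm b (ℚ.- c)) ⟩
    a ℚ.+ ((ℚ.- c ℚ.+ b) ℚ.+ ℚ.- d)
      ≡⟨ cong (a ℚ.+_) (ℚₚ.+-assoc (ℚ.- c) b (ℚ.- d)) ⟩
    a ℚ.+ (ℚ.- c ℚ.+ (b ℚ.- d))
      ≡⟨ sym (ℚₚ.+-assoc a (ℚ.- c) _) ⟩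
    (a ℚ.- c) ℚ.+ (b ℚ.- d) ∎
    where open ≡-Reasoning

  halves : ∀ ε → ½ ℚ.* ε ℚ.+ ½ ℚ.* ε ≡ ε
  halves ε = trans (sym (ℚₚ.*-distribʳ-+ ε ½ ½)) (ℚₚ.*-identityˡ ε)

  half-pos : ∀ ε → 0ℚ ℚ.< ε → 0ℚ ℚ.< ½ ℚ.* ε
  half-pos ε 0<ε = subst (ℚ._< ½ ℚ.* ε) (ℚₚ.*-zeroʳ ½) (ℚₚ.*-monoʳ-<-pos ½ 0<ε)

_+ʳ_ : ℝ → ℝ → ℝ
x +ʳ y = mkℝ (λ n → seq x n ℚ.+ seq y n) λ ε 0<ε →
  let M , p = cauchy x (½ ℚ.* ε) (half-pos ε 0<ε)
      N , q = cauchy y (½ ℚ.* ε) (half-pos ε 0<ε)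
  in M ⊔ N , λ m n m≥ n≥ → let open ℚₚ.≤-Reasoning in begin-strict
    ℚ.∣ (seq x m ℚ.+ seq y m) ℚ.- (seq x n ℚ.+ seq y n) ∣
      ≡⟨ cong ℚ.∣_∣ (interchange (seq x m) (seq y m) (seq x n) (seq y n)) ⟩
    ℚ.∣ (seq x m ℚ.- seq x n) ℚ.+ (seq y m ℚ.- seq y n) ∣
      ≤⟨ ℚₚ.∣p+q∣≤∣p∣+∣q∣ (seq x m ℚ.- seq x n) (seq y m ℚ.- seq y n) ⟩
    ℚ.∣ seq x m ℚ.- seq x n ∣ ℚ.+ ℚ.∣ seq y m ℚ.- seq y n ∣
      <⟨ ℚₚ.+-mono-< (p m n (ℕₚ.m⊔n≤o⇒m≤o M N m≥) (ℕₚ.m⊔n≤o⇒m≤o M N n≥))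
                     (q m n (ℕₚ.m⊔n≤o⇒n≤o M N m≥) (ℕₚ.m⊔n≤o⇒n≤o M N n≥)) ⟩
    ½ ℚ.* ε ℚ.+ ½ ℚ.* ε
      ≡⟨ halves ε ⟩
    ε ∎

_∈[0,1⟩ : ℝ → Set
x ∈[0,1⟩ = 0ʳ ≤ʳ x × x <ʳ 1ʳ

IsLimsup : (ℕ → ℚ) → ℝ → Set
IsLimsup a x = ∀ ε → 0ℚ ℚ.< ε →
  (∃ λ N → ∀ n → N ℕ.≤ n → fromℚ (a n) <ʳ x +ʳ fromℚ ε) ×
  (∀ N → ∃ λ n → N ℕ.≤ n × x <ʳ fromℚ (a n) +ʳ fromℚ ε)

DenseIn[0,1⟩ : ∀ {a} → (ℝ → Set a) → Set a
DenseIn[0,1⟩ P = ∀ x → x ∈[0,1⟩ → ∀ ε → 0ʳ <ʳ ε →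
  ∃ λ y → P y × y ∈[0,1⟩ × x <ʳ y +ʳ ε × y <ʳ x +ʳ ε

-- A k-graph with vertex set Fin n; a set of edges is given by its
-- characteristic function.

record KGraph (k n : ℕ) : Set where
  constructor mkKGraph
  field
    edge    : Subset n → Bool
    uniform : ∀ S → T (edge S) → ∣ S ∣ ≡ k

open KGraph public

subsets : ∀ n → List (Subset n)
subsets zero    = [] ∷ []
subsets (suc n) = map (outside ∷_) (subsets n) ++ map (inside ∷_) (subsets n)

subsetsOfSize : ∀ n → ℕ → List (Subset n)
subsetsOfSize n r = filterᵇ (λ S → ∣ S ∣ ≡ᵇ r) (subsets n)

degree : ∀ {k n} → ℕ → KGraph k n → Subset n → ℕ
degree {k} {n} ℓ H U =
  length (filterᵇ (λ S → edge H (S ∪ U)) (subsetsOfSize n (k ∸ ℓ)))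

-- The value 0 on the empty list is only used for ℓ-degrees of graphs with
-- fewer than ℓ vertices, which do not affect the limit superior.
minimum : List ℕ → ℕ
minimum []       = 0
minimum (x ∷ xs) = min x xs

minDegree : ∀ {k n} → ℕ → KGraph k n → ℕ
minDegree {n = n} ℓ H = minimum (map (degree ℓ H) (subsetsOfSize n ℓ))

image : ∀ {m n} → (Fin m → Fin n) → Subset m → Subset n
image f S = ⋃ (map (⁅_⁆ ∘ f) (filter (_∈? S) (allFin _)))

Contains : ∀ {k m n} → KGraph k n → KGraph k m → Set
Contains {m = m} {n} H G = Σ (Fin m → Fin n) λ f →
  Injective _≡_ _≡_ f × (∀ S → T (edge G S) → T (edge H (image f S)))

Family : ℕ → Set₁
Family k = ∀ n → KGraph k n → Set

Free : ∀ {k n} → Family k → KGraph k n → Set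
Free ℱ H = ∀ m G → ℱ m G → ¬ Contains H G

-- IsEx ℓ ℱ n e says that ex_ℓ(n, ℱ) = e.
IsEx : ∀ {k} → ℕ → Family k → ℕ → ℕ → Set
IsEx {k} ℓ ℱ n e =
  ((∃ λ (H : KGraph k n) → Free ℱ H × minDegree ℓ H ≡ e) ×
   (∀ (H : KGraph k n) → Free ℱ H → minDegree ℓ H ℕ.≤ e))
  ⊎ ((∀ (H : KGraph k n) → ¬ Free ℱ H) × e ≡ 0)

-- Division by 0 occurs only in the finitely many terms with n < k ∸ ℓ.
ratio : ℕ → ℕ → ℚ
ratio m zero    = 0ℚ
ratio m (suc d) = (ℤ.+ m) ℚ./ suc d

-- IsTuranDensity ℓ ℱ x says that π_ℓ(ℱ) = x.
IsTuranDensity : ∀ {k} → ℕ → Family k → ℝ → Set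
IsTuranDensity {k} ℓ ℱ x = Σ (ℕ → ℕ) λ ex →
  (∀ n → IsEx ℓ ℱ n (ex n)) × IsLimsup (λ n → ratio (ex n) (n C (k ∸ ℓ))) x

Π : ℕ → ℕ → ℝ → Set₁
Π k ℓ x = Σ (Family k) λ ℱ → IsTuranDensity ℓ ℱ x

IsJump : ℕ → ℕ → ℝ → Set₁
IsJump k ℓ α = ∃ λ δ → 0ʳ <ʳ δ ×
  ((ℱ : Family k) → ¬ (∃ λ x → IsTuranDensity ℓ ℱ x × α <ʳ x × x <ʳ α +ʳ δ))

{-# OPTIONS --safe #-}
-- Put the vertices on a circle with m sites and call a k-set an edge if, whenever ℓ of its
-- vertices sit at the same site i, all others sit at i + 1, …, i + a.  With r = k - ℓ and m
-- large, every ℓ-set has degree at least about (a / m) ^ r times the number of r-sets: an ℓ-set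
-- inside one site sees all the rainbow r-sets of its arc, and any other ℓ-set, because ℓ ≥ 2, all
-- rainbow r-sets avoiding its sites.  Conversely, every large set W of vertices contains an
-- ℓ-set of degree at most about (a / m) ^ r inside W: some site i with at least ℓ points of W has
-- at most about a |W| / m points of W on its arc.  Hence forbidding all large graphs whose
-- minimum ℓ-degree exceeds this value gives a Turán density close to (a / m) ^ r, and these
-- numbers are dense in [0, 1).
module Submission where

open import Defs
open import Axiom.ExcludedMiddle using (ExcludedMiddle)
open import Data.Product using (Σ; ∃; _×_; _,_; proj₁; proj₂)
open import Data.Sum using (_⊎_; inj₁; inj₂)
open import Function using (_∘_; id; Equivalence; case_of_)
open import Level using (0ℓ)
open import Relation.Binary.PropositionalEquality
open import Relation.Nullary using (¬_; Dec; contradiction; yes; no; does; ¬?; ⌊_⌋)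

-- The upper bound on the density costs nothing, since a large graph that is too dense is itself
-- forbidden and contains itself. The work lies in showing that no large piece of the circular
-- graph, however unevenly spread over the sites, is too dense. Small pieces must be exempt: a
-- vertex set with fewer than `ℓ` vertices at each site spans a complete graph. For a large piece,
-- averaging over all arcs yields an arc with few points, but its site may hold fewer than `ℓ` of
-- them, and then no `ℓ`-set is confined to that arc. The site is therefore found by a cycle-lemma
-- argument, which takes the maximum of a periodic function and so can insist on a site of positive
-- weight; only points at sites with at least `ℓ` points receive weight. The Turán density is never
-- computed. It is trapped between the `r`-th powers of two consecutive fractions `j / M` and
-- `(j + 1) / M`, and these are chosen to fit into a prescribed rational interval.

module Combinatorics where

  import Algebra.Properties.CommutativeMonoid.Sum
  open import Data.Bool using (Bool; true; false; T; not; _∧_; _∨_)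
  open import Data.Bool.Properties using (T?; T-∧; T-≡)
  open import Data.Fin using (Fin; zero; suc; toℕ; fromℕ<; _↑ˡ_; _↑ʳ_; combine; quotient)
  import Data.Fin.Properties as Finₚ
  open import Data.Fin.Subset
    using (Subset; inside; outside; ∣_∣; _⊆_; _∈_; _∉_; _-_; _∪_; _∩_; ⁅_⁆; ⊤; ⋃) renaming (⊥ to ∅)
  open import Data.Fin.Subset.Properties
    using (p─⊥≡p; p─q⊆p; x∈⁅x⁆; x∈⁅y⁆⇒x≡y; x∈p⇒∣p-x∣<∣p∣; x∈p∧x≢y⇒x∈p-y; ∣⊤∣≡n; ∉⊥; ∣⊥∣≡0;
           x∈p∪q⁺; x∈p∪q⁻; x∈p∩q⁺; x∈p∩q⁻; drop-∷-⊆; ⊆-antisym; p⊆q⇒∣p∣≤∣q∣; ∣p∣≤n; _∈?_)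
  open import Data.List as List using (List; filterᵇ; filter; length; allFin)
  open import Data.List.Extrema.Nat using (argmin-all; min≤⊤; min≤xs)
  open import Data.List.Membership.Propositional renaming (_∈_ to _∈ˡ_) using ()
  open import Data.List.Membership.Propositional.Properties
    using (∈-map⁺; ∈-++⁺ˡ; ∈-++⁺ʳ; ∈-filter⁺; ∈-filter⁻; ∈-allFin)
  open import Data.List.Relation.Unary.All as All using (All)
  import Data.List.Relation.Unary.All.Properties as Allₚ
  import Data.List.Relation.Unary.Any as Any
  open import Data.Nat hiding (∣_-_∣)
  open import Data.Nat.Combinatorics using (_C_; nCk+nC[k+1]≡[n+1]C[k+1]; nC1≡n)
  open import Data.Nat.Properties
  open import Data.Nat.Tactic.RingSolver using (solve-∀)
  open import Data.Unit using (tt)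
  open import Data.Vec using ([]; _∷_; lookup; tabulate; _[_]≔_; here; there)
  open import Data.Vec.Properties using (lookup∘tabulate; []=⇒lookup; lookup⇒[]=; lookup∘update′)
  open import Function.Definitions using (Injective)
  open import Relation.Binary.Definitions using (tri<; tri≈; tri>)
  open import Relation.Nullary.Decidable using (toWitness; fromWitness; decidable-stable; _×-dec_)
  open Algebra.Properties.CommutativeMonoid.Sum +-0-commutativeMonoid
    using (sum; ∑-comm; ∑-distrib-+; sum-cong-≗)

  -- Finite sums over `Fin n`.

  χ : Bool → ℕ
  χ true  = 1
  χ false = 0

  sum-mono-≤ : ∀ {n} {f g : Fin n → ℕ} → (∀ i → f i ≤ g i) → sum f ≤ sum g
  sum-mono-≤ {zero}  f≤g = z≤n
  sum-mono-≤ {suc n} f≤g = +-mono-≤ (f≤g zero) (sum-mono-≤ (f≤g ∘ suc))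

  sum-const : ∀ n c → sum {n} (λ _ → c) ≡ n * c
  sum-const zero    c = refl
  sum-const (suc n) c = cong (c +_) (sum-const n c)

  *-distribʳ-sum : ∀ {n} c (f : Fin n → ℕ) → sum (λ i → f i * c) ≡ sum f * c
  *-distribʳ-sum {zero}  c f = refl
  *-distribʳ-sum {suc n} c f =
    trans (cong (f zero * c +_) (*-distribʳ-sum c (f ∘ suc)))
          (sym (*-distribʳ-+ c (f zero) _))

  sum-zero : ∀ n → sum {n} (λ _ → 0) ≡ 0
  sum-zero n = trans (sum-const n 0) (*-zeroʳ n)

  sum-++ : ∀ s u (f : Fin (s + u) → ℕ) →
    sum f ≡ sum (λ i → f (i ↑ˡ u)) + sum (λ j → f (s ↑ʳ j))
  sum-++ zero    u f = refl
  sum-++ (suc s) u f = trans (cong (f zero +_) (sum-++ s u (f ∘ suc)))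
                             (sym (+-assoc (f zero) _ _))

  sum-combine : ∀ m t (f : Fin (m * t) → ℕ) →
    sum f ≡ sum (λ i → sum (λ j → f (combine {m} i j)))
  sum-combine zero    t f = refl
  sum-combine (suc m) t f =
    trans (sum-++ t (m * t) f) (cong (sum (λ i → f (i ↑ˡ (m * t))) +_) (sum-combine m t (λ j → f (t ↑ʳ j))))

  sum-quotient : ∀ m t (f : Fin m → ℕ) → sum (f ∘ quotient {m} t) ≡ sum f * t
  sum-quotient m t f = begin
    sum (f ∘ quotient {m} t)
      ≡⟨ sum-combine m t _ ⟩
    sum (λ i → sum (λ j → f (quotient {m} t (combine {m} i j))))
      ≡⟨ sum-cong-≗ {m} (λ i → sum-cong-≗ {t} (λ j → cong (f ∘ proj₁) (Finₚ.remQuot-combine {m} i j))) ⟩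
    sum (λ i → sum {t} (λ _ → f i))
      ≡⟨ sum-cong-≗ {m} (λ i → trans (sum-const t (f i)) (*-comm t (f i))) ⟩
    sum (λ i → f i * t)
      ≡⟨ *-distribʳ-sum t f ⟩
    sum f * t ∎
    where open ≡-Reasoning

  ∣_∣≡sum : ∀ {n} (S : Subset n) → ∣ S ∣ ≡ sum (χ ∘ lookup S)
  ∣ []          ∣≡sum = refl
  ∣ outside ∷ S ∣≡sum = ∣ S ∣≡sum
  ∣ inside  ∷ S ∣≡sum = cong suc ∣ S ∣≡sum

  -- Counting the subsets of a given size.

  count : ∀ n → ℕ → (Subset n → Bool) → ℕ
  count zero    zero    p = χ (p [])
  count zero    (suc r) p = 0
  count (suc n) zero    p = count n zero (p ∘ (outside ∷_))
  count (suc n) (suc r) p = count n (suc r) (p ∘ (outside ∷_)) + count n r (p ∘ (inside ∷_))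

  private
    length-filterᵇ²-map : ∀ {A B : Set} (f : A → B) p q xs →
      length (filterᵇ p (filterᵇ q (List.map f xs)))
        ≡ length (filterᵇ (p ∘ f) (filterᵇ (q ∘ f) xs))
    length-filterᵇ²-map f p q List.[] = refl
    length-filterᵇ²-map f p q (x List.∷ xs) with q (f x)
    ... | false = length-filterᵇ²-map f p q xs
    ... | true with p (f x)
    ...   | false = length-filterᵇ²-map f p q xs
    ...   | true  = cong suc (length-filterᵇ²-map f p q xs)

    filterᵇ-false : ∀ {A : Set} (xs : List A) → filterᵇ (λ _ → false) xs ≡ List.[]
    filterᵇ-false List.[]       = refl
    filterᵇ-false (x List.∷ xs) = filterᵇ-false xs

    length-filterᵇ²-++ : ∀ {A : Set} (p q : A → Bool) xs ys →
      length (filterᵇ p (filterᵇ q (xs List.++ ys)))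
        ≡ length (filterᵇ p (filterᵇ q xs)) + length (filterᵇ p (filterᵇ q ys))
    length-filterᵇ²-++ p q List.[] ys = refl
    length-filterᵇ²-++ p q (x List.∷ xs) ys with q x
    ... | false = length-filterᵇ²-++ p q xs ys
    ... | true with p x
    ...   | false = length-filterᵇ²-++ p q xs ys
    ...   | true  = cong suc (length-filterᵇ²-++ p q xs ys)

  -- Trades the filtered list in `degree` for `count`, whose recursion on the first vertex follows
  -- Pascal's rule and suits the inductions below.
  length-filterᵇ-subsetsOfSize : ∀ n r p →
    length (filterᵇ p (subsetsOfSize n r)) ≡ count n r p
  length-filterᵇ-subsetsOfSize zero zero p with p []
  ... | true  = refl
  ... | false = refl
  length-filterᵇ-subsetsOfSize zero (suc r) p = refl
  length-filterᵇ-subsetsOfSize (suc n) r p = trans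
    (length-filterᵇ²-++ p (λ S → ∣ S ∣ ≡ᵇ r) (List.map (outside ∷_) (subsets n)) _)
    (trans (cong₂ _+_ (length-filterᵇ²-map (outside ∷_) p _ (subsets n))
                      (length-filterᵇ²-map (inside ∷_) p _ (subsets n)))
           (split r))
    where
    split : ∀ r →
      length (filterᵇ (p ∘ (outside ∷_)) (subsetsOfSize n r)) +
      length (filterᵇ (p ∘ (inside ∷_)) (filterᵇ (λ S → suc ∣ S ∣ ≡ᵇ r) (subsets n)))
        ≡ count (suc n) r p
    split zero = trans
      (cong₂ _+_ (length-filterᵇ-subsetsOfSize n zero _)
                 (cong (length ∘ filterᵇ (p ∘ (inside ∷_))) (filterᵇ-false (subsets n))))
      (+-identityʳ _)
    split (suc r) = cong₂ _+_ (length-filterᵇ-subsetsOfSize n (suc r) _)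
                              (length-filterᵇ-subsetsOfSize n r _)

  private
    χ-mono : ∀ {b c} → (T b → T c) → χ b ≤ χ c
    χ-mono {false}         _ = z≤n
    χ-mono {true}  {true}  _ = ≤-refl
    χ-mono {true}  {false} f = contradiction (f tt) (λ ())

  count-mono : ∀ n r {p q} → (∀ S → ∣ S ∣ ≡ r → T (p S) → T (q S)) →
    count n r p ≤ count n r q
  count-mono zero    zero    p⇒q = χ-mono (p⇒q [] refl)
  count-mono zero    (suc r) p⇒q = z≤n
  count-mono (suc n) zero    p⇒q = count-mono n zero (p⇒q ∘ (outside ∷_))
  count-mono (suc n) (suc r) p⇒q = +-mono-≤
    (count-mono n (suc r) (p⇒q ∘ (outside ∷_)))
    (count-mono n r (λ S eq → p⇒q (inside ∷ S) (cong suc eq)))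

  count-false : ∀ n r → count n r (λ _ → false) ≡ 0
  count-false zero    zero    = refl
  count-false zero    (suc r) = refl
  count-false (suc n) zero    = count-false n zero
  count-false (suc n) (suc r) = cong₂ _+_ (count-false n (suc r)) (count-false n r)

  -- Double counting of the pairs (v, S) with v ∈ S and |S| = r + 1.
  suc*count≡sum : ∀ n r p →
    suc r * count n (suc r) p
      ≡ sum (λ v → count n r (λ S → not (lookup S v) ∧ p (S [ v ]≔ inside)))
  suc*count≡sum zero    r       p = *-zeroʳ (suc r)
  suc*count≡sum (suc n) zero    p = trans
    (regroup (count n 1 (p ∘ (outside ∷_))) (count n 0 (p ∘ (inside ∷_))))
    (cong (count n 0 (p ∘ (inside ∷_)) +_) (suc*count≡sum n zero (p ∘ (outside ∷_))))
    where
    regroup : ∀ a b → a + b + 0 ≡ b + (a + 0)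
    regroup = solve-∀
  suc*count≡sum (suc n) (suc r) p = begin
    suc (suc r) * (a + b)
      ≡⟨ expand r a b ⟩
    (b + 0) + (suc (suc r) * a + suc r * b)
      -- The bracket `b + 0` is the summand of the vertex `zero`: sets without it are extended by it
      -- and counted by `b`, sets with it fail the test. The other vertices give `f` and `g`,
      -- according to whether the set contains `zero`.
      ≡⟨ cong₂ (λ x y → (b + x) + y) (sym (count-false n r))
           (cong₂ _+_ (suc*count≡sum n (suc r) (p ∘ (outside ∷_)))
                      (suc*count≡sum n r (p ∘ (inside ∷_)))) ⟩
    (b + count n r (λ _ → false)) + (sum f + sum g)
      ≡⟨ cong ((b + count n r (λ _ → false)) +_) (sym (∑-distrib-+ f g)) ⟩
    _ ∎
    where
    open ≡-Reasoning
    a = count n (suc (suc r)) (p ∘ (outside ∷_))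
    b = count n (suc r) (p ∘ (inside ∷_))
    f = λ v → count n (suc r) (λ S → not (lookup S v) ∧ p (outside ∷ S [ v ]≔ inside))
    g = λ v → count n r (λ S → not (lookup S v) ∧ p (inside ∷ S [ v ]≔ inside))
    expand : ∀ r a b → suc (suc r) * (a + b) ≡ (b + 0) + (suc (suc r) * a + suc r * b)
    expand = solve-∀

  χ≤1 : ∀ b → χ b ≤ 1
  χ≤1 true  = ≤-refl
  χ≤1 false = z≤n

  count-⊆-≤ : ∀ n r {p} (X : Subset n) → (∀ S → T (p S) → S ⊆ X) → count n r p ≤ ∣ X ∣ C r
  count-⊆-≤ zero    zero    []             p⇒⊆ = χ≤1 _
  count-⊆-≤ zero    (suc r) []             p⇒⊆ = z≤n
  count-⊆-≤ (suc n) zero    (x ∷ X)        p⇒⊆ =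
    count-⊆-≤ n zero X (λ S pS → drop-∷-⊆ (p⇒⊆ (outside ∷ S) pS))
  count-⊆-≤ (suc n) (suc r) (inside ∷ X)  p⇒⊆ = ≤-trans
    (+-mono-≤ (count-⊆-≤ n (suc r) X (λ S pS → drop-∷-⊆ (p⇒⊆ (outside ∷ S) pS)))
              (count-⊆-≤ n r X (λ S pS → drop-∷-⊆ (p⇒⊆ (inside ∷ S) pS))))
    (≤-reflexive (trans (+-comm (∣ X ∣ C suc r) (∣ X ∣ C r)) (nCk+nC[k+1]≡[n+1]C[k+1] ∣ X ∣ r)))
  count-⊆-≤ (suc n) (suc r) {p} (outside ∷ X) p⇒⊆ = ≤-trans
    (+-mono-≤ (count-⊆-≤ n (suc r) X (λ S pS → drop-∷-⊆ (p⇒⊆ (outside ∷ S) pS)))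
              (≤-trans (count-mono n r {q = λ _ → false} (λ S _ pS → absurd (p⇒⊆ (inside ∷ S) pS)))
                       (≤-reflexive (count-false n r))))
    (≤-reflexive (+-identityʳ _))
    where
    absurd : ∀ {S : Subset n} → (inside ∷ S) ⊆ (outside ∷ X) → T false
    absurd sub with () ← sub here

  -- Powers and binomial coefficients.

  ^-distribʳ-* : ∀ k m n → (m * n) ^ k ≡ m ^ k * n ^ k
  ^-distribʳ-* zero    m n = refl
  ^-distribʳ-* (suc k) m n = trans (cong (m * n *_) (^-distribʳ-* k m n)) (interchange m n (m ^ k) (n ^ k))
    where
    interchange : ∀ a b c d → a * b * (c * d) ≡ a * c * (b * d)
    interchange = solve-∀

  -- The absorption identity of `[1+k]*nC[1+k]≡[n∸k]*nCk` with the subtraction moved across, so that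
  -- induction by Pascal's rule stays within semiring identities.
  [1+k]*nC[1+k]+k*nCk≡n*nCk : ∀ n k → suc k * (n C suc k) + k * (n C k) ≡ n * (n C k)
  [1+k]*nC[1+k]+k*nCk≡n*nCk n zero = trans (+-identityʳ _)
    (trans (+-identityʳ _) (trans (nC1≡n n) (sym (*-identityʳ n))))
  [1+k]*nC[1+k]+k*nCk≡n*nCk zero (suc k) = cong₂ _+_ (*-zeroʳ (suc (suc k))) (*-zeroʳ (suc k))
  [1+k]*nC[1+k]+k*nCk≡n*nCk (suc n) (suc k) = begin
    suc (suc k) * (suc n C suc (suc k)) + suc k * (suc n C suc k)
      ≡⟨ cong₂ (λ x y → suc (suc k) * x + suc k * y)
           (sym (nCk+nC[k+1]≡[n+1]C[k+1] n (suc k))) (sym (nCk+nC[k+1]≡[n+1]C[k+1] n k)) ⟩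
    suc (suc k) * (b + c) + suc k * (a + b)
      ≡⟨ expand k a b c ⟩
    (suc (suc k) * c + suc k * b) + (suc k * b + k * a) + (a + b)
      ≡⟨ cong₂ (λ x y → x + y + (a + b)) ([1+k]*nC[1+k]+k*nCk≡n*nCk n (suc k))
           ([1+k]*nC[1+k]+k*nCk≡n*nCk n k) ⟩
    n * b + n * a + (a + b)
      ≡⟨ collect n a b ⟩
    suc n * (a + b)
      ≡⟨ cong (suc n *_) (nCk+nC[k+1]≡[n+1]C[k+1] n k) ⟩
    suc n * (suc n C suc k) ∎
    where
    open ≡-Reasoning
    a = n C k
    b = n C suc k
    c = n C suc (suc k)
    expand : ∀ k a b c → suc (suc k) * (b + c) + suc k * (a + b)
      ≡ (suc (suc k) * c + suc k * b) + (suc k * b + k * a) + (a + b)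
    expand = solve-∀
    collect : ∀ n a b → n * b + n * a + (a + b) ≡ suc n * (a + b)
    collect = solve-∀

  [1+k]*nC[1+k]≡[n∸k]*nCk : ∀ n k → suc k * (n C suc k) ≡ (n ∸ k) * (n C k)
  [1+k]*nC[1+k]≡[n∸k]*nCk n k = begin
    suc k * (n C suc k)
      ≡⟨ sym (m+n∸n≡m _ (k * (n C k))) ⟩
    suc k * (n C suc k) + k * (n C k) ∸ k * (n C k)
      ≡⟨ cong (_∸ k * (n C k)) ([1+k]*nC[1+k]+k*nCk≡n*nCk n k) ⟩
    n * (n C k) ∸ k * (n C k)
      ≡⟨ sym (*-distribʳ-∸ (n C k) n k) ⟩
    (n ∸ k) * (n C k) ∎
    where open ≡-Reasoning

  nCk*k!≤n^k : ∀ n k → (n C k) * k ! ≤ n ^ k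
  nCk*k!≤n^k n zero    = ≤-refl
  nCk*k!≤n^k n (suc k) = begin
    (n C suc k) * (suc k * k !)    ≡⟨ regroup (n C suc k) (suc k) (k !) ⟩
    suc k * (n C suc k) * k !      ≡⟨ cong (_* k !) ([1+k]*nC[1+k]≡[n∸k]*nCk n k) ⟩
    (n ∸ k) * (n C k) * k !        ≡⟨ *-assoc (n ∸ k) (n C k) (k !) ⟩
    (n ∸ k) * ((n C k) * k !)      ≤⟨ *-mono-≤ (m∸n≤m n k) (nCk*k!≤n^k n k) ⟩
    n * n ^ k                      ∎
    where
    open ≤-Reasoning
    regroup : ∀ c s f → c * (s * f) ≡ s * c * f
    regroup = solve-∀

  -- The quotient of the two binomial coefficients is the product of the factors
  -- `(q - i) / (n - i)`, each at most `q / n`.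
  qCk*n^k≤nCk*q^k : ∀ {q n} → q ≤ n → ∀ k → (q C k) * n ^ k ≤ (n C k) * q ^ k
  qCk*n^k≤nCk*q^k         q≤n zero    = ≤-refl
  qCk*n^k≤nCk*q^k {q} {n} q≤n (suc k) = *-cancelˡ-≤ (suc k) (begin
    suc k * ((q C suc k) * (n * n ^ k))
      ≡⟨ sym (*-assoc (suc k) (q C suc k) _) ⟩
    suc k * (q C suc k) * (n * n ^ k)
      ≡⟨ cong (_* (n * n ^ k)) ([1+k]*nC[1+k]≡[n∸k]*nCk q k) ⟩
    (q ∸ k) * (q C k) * (n * n ^ k)
      ≡⟨ interchange (q ∸ k) (q C k) n (n ^ k) ⟩
    ((q ∸ k) * n) * ((q C k) * n ^ k)
      ≤⟨ *-mono-≤ factor (qCk*n^k≤nCk*q^k q≤n k) ⟩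
    ((n ∸ k) * q) * ((n C k) * q ^ k)
      ≡⟨ sym (interchange (n ∸ k) (n C k) q (q ^ k)) ⟩
    (n ∸ k) * (n C k) * (q * q ^ k)
      ≡⟨ cong (_* (q * q ^ k)) (sym ([1+k]*nC[1+k]≡[n∸k]*nCk n k)) ⟩
    suc k * (n C suc k) * (q * q ^ k)
      ≡⟨ *-assoc (suc k) (n C suc k) _ ⟩
    suc k * ((n C suc k) * (q * q ^ k)) ∎)
    where
    open ≤-Reasoning
    interchange : ∀ a b c d → a * b * (c * d) ≡ (a * c) * (b * d)
    interchange = solve-∀
    factor : (q ∸ k) * n ≤ (n ∸ k) * q
    factor = begin
      (q ∸ k) * n      ≡⟨ *-distribʳ-∸ n q k ⟩
      q * n ∸ k * n    ≤⟨ ∸-monoʳ-≤ (q * n) (*-monoʳ-≤ k q≤n) ⟩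
      q * n ∸ k * q    ≡⟨ cong (_∸ k * q) (*-comm q n) ⟩
      n * q ∸ k * q    ≡⟨ sym (*-distribʳ-∸ q n k) ⟩
      (n ∸ k) * q      ∎

  -- In fractions: a share `q / n ≤ b / m` of the vertices spans at most a share `(b / m) ^ k` of
  -- the `k`-sets.
  m^k*d≤b^k*nCk : ∀ k {m b q n d} → 0 < n → q ≤ n → m * q ≤ b * n → d ≤ q C k →
    m ^ k * d ≤ b ^ k * (n C k)
  m^k*d≤b^k*nCk k {m} {b} {q} {n} {d} 0<n q≤n mq≤bn d≤ = *-cancelʳ-≤ (m ^ k * d) (b ^ k * (n C k)) (n ^ k)
    {{m^n≢0 n k {{>-nonZero 0<n}}}} (begin
    m ^ k * d * n ^ k            ≤⟨ *-monoˡ-≤ (n ^ k) (*-monoʳ-≤ (m ^ k) d≤) ⟩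
    m ^ k * (q C k) * n ^ k      ≡⟨ *-assoc (m ^ k) (q C k) (n ^ k) ⟩
    m ^ k * ((q C k) * n ^ k)    ≤⟨ *-monoʳ-≤ (m ^ k) (qCk*n^k≤nCk*q^k q≤n k) ⟩
    m ^ k * ((n C k) * q ^ k)    ≡⟨ regroup (m ^ k) (n C k) (q ^ k) ⟩
    (n C k) * (m ^ k * q ^ k)    ≡⟨ cong ((n C k) *_) (sym (^-distribʳ-* k m q)) ⟩
    (n C k) * (m * q) ^ k        ≤⟨ *-monoʳ-≤ (n C k) (^-monoˡ-≤ k mq≤bn) ⟩
    (n C k) * (b * n) ^ k        ≡⟨ cong ((n C k) *_) (^-distribʳ-* k b n) ⟩
    (n C k) * (b ^ k * n ^ k)    ≡⟨ regroup′ (n C k) (b ^ k) (n ^ k) ⟩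
    b ^ k * (n C k) * n ^ k      ∎)
    where
    open ≤-Reasoning
    regroup : ∀ x y z → x * (y * z) ≡ y * (x * z)
    regroup = solve-∀
    regroup′ : ∀ x y z → x * (y * z) ≡ y * x * z
    regroup′ = solve-∀

  -- Sizes and enumerations of subsets.

  ∣p∪q∣+∣p∩q∣≡∣p∣+∣q∣ : ∀ {n} (p q : Subset n) → ∣ p ∪ q ∣ + ∣ p ∩ q ∣ ≡ ∣ p ∣ + ∣ q ∣
  ∣p∪q∣+∣p∩q∣≡∣p∣+∣q∣ []            []            = refl
  ∣p∪q∣+∣p∩q∣≡∣p∣+∣q∣ (outside ∷ p) (outside ∷ q) = ∣p∪q∣+∣p∩q∣≡∣p∣+∣q∣ p q
  ∣p∪q∣+∣p∩q∣≡∣p∣+∣q∣ (outside ∷ p) (inside  ∷ q) =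
    trans (cong suc (∣p∪q∣+∣p∩q∣≡∣p∣+∣q∣ p q)) (sym (+-suc ∣ p ∣ ∣ q ∣))
  ∣p∪q∣+∣p∩q∣≡∣p∣+∣q∣ (inside  ∷ p) (outside ∷ q) = cong suc (∣p∪q∣+∣p∩q∣≡∣p∣+∣q∣ p q)
  ∣p∪q∣+∣p∩q∣≡∣p∣+∣q∣ (inside  ∷ p) (inside  ∷ q) = cong suc (trans (+-suc _ ∣ p ∩ q ∣)
    (trans (cong suc (∣p∪q∣+∣p∩q∣≡∣p∣+∣q∣ p q)) (sym (+-suc ∣ p ∣ ∣ q ∣))))

  disjoint⇒∣p∩q∣≡0 : ∀ {n} (p q : Subset n) → (∀ x → x ∈ p → x ∉ q) → ∣ p ∩ q ∣ ≡ 0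
  disjoint⇒∣p∩q∣≡0 {n} p q dis = n≤0⇒n≡0 (≤-trans
    (p⊆q⇒∣p∣≤∣q∣ {q = ∅} (λ x∈ → let x∈p , x∈q = x∈p∩q⁻ p q x∈ in contradiction x∈q (dis _ x∈p)))
    (≤-reflexive (∣⊥∣≡0 n)))

  x∈p⇒0<∣p∣ : ∀ {n x} {p : Subset n} → x ∈ p → 0 < ∣ p ∣
  x∈p⇒0<∣p∣ x∈p = ≤-<-trans z≤n (x∈p⇒∣p-x∣<∣p∣ x∈p)

  ∣p∣≤1+∣p-x∣ : ∀ {n} (p : Subset n) x → ∣ p ∣ ≤ suc ∣ p - x ∣
  ∣p∣≤1+∣p-x∣ (outside ∷ p) zero    = m≤n⇒m≤1+n (≤-reflexive (cong ∣_∣ (sym (p─⊥≡p p))))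
  ∣p∣≤1+∣p-x∣ (inside  ∷ p) zero    = s≤s (≤-reflexive (cong ∣_∣ (sym (p─⊥≡p p))))
  ∣p∣≤1+∣p-x∣ (outside ∷ p) (suc x) = ∣p∣≤1+∣p-x∣ p x
  ∣p∣≤1+∣p-x∣ (inside  ∷ p) (suc x) = s≤s (∣p∣≤1+∣p-x∣ p x)

  x∉p-x : ∀ {n} (p : Subset n) x → x ∉ p - x
  x∉p-x (outside ∷ p) zero    ()
  x∉p-x (inside  ∷ p) zero    ()
  x∉p-x (outside ∷ p) (suc x) (there x∈) = x∉p-x p x x∈
  x∉p-x (inside  ∷ p) (suc x) (there x∈) = x∉p-x p x x∈

  ∃-⊆-ofSize : ∀ {n} (X : Subset n) ℓ → ℓ ≤ ∣ X ∣ → ∃ λ U → U ⊆ X × ∣ U ∣ ≡ ℓ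
  ∃-⊆-ofSize {n} X zero    ℓ≤ = ∅ , (λ x∈ → contradiction x∈ ∉⊥) , ∣⊥∣≡0 n
  ∃-⊆-ofSize (outside ∷ X) (suc ℓ) ℓ≤ with U , U⊆X , eq ← ∃-⊆-ofSize X (suc ℓ) ℓ≤ =
    outside ∷ U , (λ { (there x∈) → there (U⊆X x∈) }) , eq
  ∃-⊆-ofSize (inside ∷ X) (suc ℓ) (s≤s ℓ≤) with U , U⊆X , eq ← ∃-⊆-ofSize X ℓ ℓ≤ =
    inside ∷ U , (λ { here → here ; (there x∈) → there (U⊆X x∈) }) , cong suc eq

  enumerate : ∀ {n} (U : Subset n) →
    ∃ λ (u : Fin ∣ U ∣ → Fin n) → Injective _≡_ _≡_ u × (∀ j → u j ∈ U)
  enumerate []            = (λ ()) , (λ { {()} }) , λ ()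
  enumerate (outside ∷ U) with u , inj , u∈U ← enumerate U =
    suc ∘ u , (λ eq → inj (Finₚ.suc-injective eq)) , λ j → there (u∈U j)
  enumerate {suc n} (inside ∷ U) with u , inj , u∈U ← enumerate U = u′ , inj′ , u′∈U
    where
    u′ : Fin (suc ∣ U ∣) → Fin (suc n)
    u′ zero    = zero
    u′ (suc j) = suc (u j)
    inj′ : Injective _≡_ _≡_ u′
    inj′ {zero}  {zero}  eq = refl
    inj′ {suc i} {suc j} eq = cong suc (inj (Finₚ.suc-injective eq))
    u′∈U : ∀ j → u′ j ∈ inside ∷ U
    u′∈U zero    = here
    u′∈U (suc j) = there (u∈U j)

  injective⇒≤∣p∣ : ∀ {n c} (p : Subset n) (u : Fin c → Fin n) → Injective _≡_ _≡_ u →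
    (∀ j → u j ∈ p) → c ≤ ∣ p ∣
  injective⇒≤∣p∣ {c = zero}  p u inj u∈p = z≤n
  injective⇒≤∣p∣ {c = suc c} p u inj u∈p = ≤-trans
    (s≤s (injective⇒≤∣p∣ (p - u zero) (u ∘ suc) (Finₚ.suc-injective ∘ inj)
      (λ j → x∈p∧x≢y⇒x∈p-y (u∈p (suc j)) (λ eq → case inj eq of λ ()))))
    (x∈p⇒∣p-x∣<∣p∣ (u∈p zero))

  enumerate-ofSize : ∀ {n ℓ} (U : Subset n) → ∣ U ∣ ≡ ℓ →
    ∃ λ (u : Fin ℓ → Fin n) → Injective _≡_ _≡_ u × (∀ j → u j ∈ U)
  enumerate-ofSize U refl = enumerate U

  -- Pigeonhole: if `u` missed `v`, it would inject `ℓ` points into `U - v`.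
  injective⇒covers : ∀ {n ℓ} (U : Subset n) → ∣ U ∣ ≡ ℓ → (u : Fin ℓ → Fin n) → Injective _≡_ _≡_ u →
    (∀ j → u j ∈ U) → ∀ {v} → v ∈ U → ¬ (∀ j → u j ≢ v)
  injective⇒covers U refl u inj u∈U {v} v∈U v∉u = <-irrefl refl (≤-<-trans
    (injective⇒≤∣p∣ (U - v) u inj (λ j → x∈p∧x≢y⇒x∈p-y (u∈U j) (v∉u j)))
    (x∈p⇒∣p-x∣<∣p∣ v∈U))

  -- Start from all labels and delete the label of each vertex of `U`; every vertex costs at most
  -- one label.
  ∃-avoiding : ∀ {m n} (f : Fin n → Fin m) (U : Subset n) →
    ∃ λ L → m ≤ ∣ L ∣ + ∣ U ∣ × (∀ v → v ∈ U → f v ∉ L)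
  ∃-avoiding {m} f [] = ⊤ , ≤-reflexive (sym (trans (+-identityʳ _) (∣⊤∣≡n m))) , λ _ ()
  ∃-avoiding f (outside ∷ U) with L , m≤ , avoid ← ∃-avoiding (f ∘ suc) U =
    L , m≤ , λ { (suc v) (there v∈U) → avoid v v∈U }
  ∃-avoiding f (inside ∷ U) with L , m≤ , avoid ← ∃-avoiding (f ∘ suc) U =
    L - f zero ,
    ≤-trans m≤ (≤-trans (+-monoˡ-≤ ∣ U ∣ (∣p∣≤1+∣p-x∣ L (f zero))) (≤-reflexive (sym (+-suc _ ∣ U ∣)))) ,
    λ { zero here → x∉p-x L (f zero)
      ; (suc v) (there v∈U) fv∈ → avoid v v∈U (p─q⊆p L ⁅ f zero ⁆ fv∈) }

  -- Images of subsets, copies of graphs, minimum degrees.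

  ∈-⋃-map⁺ : ∀ {m n} (f : Fin m → Fin n) {x} {xs : List (Fin m)} → x ∈ˡ xs →
    f x ∈ ⋃ (List.map (⁅_⁆ ∘ f) xs)
  ∈-⋃-map⁺ f (Any.here refl)  = x∈p∪q⁺ (inj₁ (x∈⁅x⁆ _))
  ∈-⋃-map⁺ f (Any.there x∈xs) = x∈p∪q⁺ (inj₂ (∈-⋃-map⁺ f x∈xs))

  ∈-⋃-map⁻ : ∀ {m n} (f : Fin m → Fin n) {y} (xs : List (Fin m)) →
    y ∈ ⋃ (List.map (⁅_⁆ ∘ f) xs) → ∃ λ x → x ∈ˡ xs × y ≡ f x
  ∈-⋃-map⁻ f List.[] y∈ = contradiction y∈ ∉⊥
  ∈-⋃-map⁻ f (x List.∷ xs) y∈ with x∈p∪q⁻ ⁅ f x ⁆ _ y∈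
  ... | inj₁ y∈x  = x , Any.here refl , x∈⁅y⁆⇒x≡y (f x) y∈x
  ... | inj₂ y∈xs with z , z∈xs , eq ← ∈-⋃-map⁻ f xs y∈xs = z , Any.there z∈xs , eq

  ∈-image : ∀ {m n} (f : Fin m → Fin n) {S v} → v ∈ S → f v ∈ image f S
  ∈-image f {S} v∈S = ∈-⋃-map⁺ f (∈-filter⁺ (_∈? S) (∈-allFin _) v∈S)

  image-id : ∀ {n} (S : Subset n) → image id S ≡ S
  image-id S = ⊆-antisym fwd (∈-image id)
    where
    fwd : image id S ⊆ S
    fwd y∈ with x , x∈ , refl ← ∈-⋃-map⁻ id (filter (_∈? S) (allFin _)) y∈ =
      proj₂ (∈-filter⁻ (_∈? S) {xs = allFin _} x∈)

  Contains-refl : ∀ {k n} (H : KGraph k n) → Contains H H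
  Contains-refl H = id , id , λ S → subst (T ∘ edge H) (sym (image-id S))

  ∈-subsets : ∀ {n} (S : Subset n) → S ∈ˡ subsets n
  ∈-subsets []            = Any.here refl
  ∈-subsets (outside ∷ S) = ∈-++⁺ˡ (∈-map⁺ (outside ∷_) (∈-subsets S))
  ∈-subsets (inside  ∷ S) = ∈-++⁺ʳ (List.map (outside ∷_) (subsets _)) (∈-map⁺ (inside ∷_) (∈-subsets S))

  ∈-subsetsOfSize : ∀ {n r} (S : Subset n) → ∣ S ∣ ≡ r → S ∈ˡ subsetsOfSize n r
  ∈-subsetsOfSize {r = r} S eq =
    ∈-filter⁺ (T? ∘ (λ S → ∣ S ∣ ≡ᵇ r)) (∈-subsets S) (≡⇒≡ᵇ _ r eq)

  private
    minimum-all : ∀ {P : ℕ → Set} {xs x} → x ∈ˡ xs → All P xs → P (minimum xs)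
    minimum-all _ (px All.∷ pxs) = argmin-all id px pxs

    minimum-≤ : ∀ {x xs} → x ∈ˡ xs → minimum xs ≤ x
    minimum-≤ {xs = y List.∷ xs} (Any.here refl)  = min≤⊤ y xs
    minimum-≤ {xs = y List.∷ xs} (Any.there x∈xs) = All.lookup (min≤xs y xs) x∈xs

  minDegree-≤ : ∀ {k n ℓ} (H : KGraph k n) U → ∣ U ∣ ≡ ℓ → minDegree ℓ H ≤ degree ℓ H U
  minDegree-≤ {ℓ = ℓ} H U eq = minimum-≤ (∈-map⁺ (degree ℓ H) (∈-subsetsOfSize U eq))

  -- The hypothesis `ℓ ≤ n` supplies an `ℓ`-set, so the minimum is attained by a degree and is not
  -- the default 0 of the empty list.
  minDegree-all : ∀ {k n ℓ} {P : ℕ → Set} (H : KGraph k n) → ℓ ≤ n →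
    (∀ U → ∣ U ∣ ≡ ℓ → P (degree ℓ H U)) → P (minDegree ℓ H)
  minDegree-all {n = n} {ℓ} {P} H ℓ≤n P-degree
    with U , _ , eq ← ∃-⊆-ofSize ⊤ ℓ (≤-trans ℓ≤n (≤-reflexive (sym (∣⊤∣≡n n)))) =
    minimum-all {P} (∈-map⁺ (degree ℓ H) (∈-subsetsOfSize U eq))
      (Allₚ.map⁺ (All.map (λ {S} → P-degree S ∘ ≡ᵇ⇒≡ _ ℓ)
        (Allₚ.all-filter (T? ∘ (λ S → ∣ S ∣ ≡ᵇ ℓ)) (subsets n))))

  degree≡count : ∀ {k n} ℓ (H : KGraph k n) U →
    degree ℓ H U ≡ count n (k ∸ ℓ) (λ S → edge H (S ∪ U))
  degree≡count {k} {n} ℓ H U = length-filterᵇ-subsetsOfSize n (k ∸ ℓ) _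

  -- Rainbow sets and their number.

  count-zero : ∀ n {p} → T (p ∅) → count n 0 p ≡ 1
  count-zero zero    {p} p∅ with true ← p [] = refl
  count-zero (suc n) p∅ = count-zero n p∅

  ∈-[]≔⁻ : ∀ {n} {S : Subset n} {v w} → w ∈ S [ v ]≔ inside → w ≡ v ⊎ w ∈ S
  ∈-[]≔⁻ {S = S} {v} {w} w∈ with w Finₚ.≟ v
  ... | yes w≡v = inj₁ w≡v
  ... | no  w≢v = inj₂ (lookup⇒[]= w S (trans (sym (lookup∘update′ w≢v S inside)) ([]=⇒lookup w∈)))

  Rainbow : ∀ {m n} → (Fin n → Fin m) → Subset m → Subset n → Set
  Rainbow lab L S = (∀ {v} → v ∈ S → lab v ∈ L) ×
                    (∀ {v w} → v ∈ S → w ∈ S → lab v ≡ lab w → v ≡ w)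

  Rainbow-extend : ∀ {m n} {lab : Fin n → Fin m} {L S v} → lab v ∈ L →
    Rainbow lab (L - lab v) S → v ∉ S × Rainbow lab L (S [ v ]≔ inside)
  Rainbow-extend {lab = lab} {L} {S} {v} v∈L (S⊆L , inj) =
    (λ v∈S → x∉p-x L (lab v) (S⊆L v∈S)) , S′⊆L , inj′
    where
    fresh : ∀ {w} → w ∈ S → lab v ≢ lab w
    fresh w∈S eq = x∉p-x L (lab v) (subst (_∈ L - lab v) (sym eq) (S⊆L w∈S))
    S′⊆L : ∀ {w} → w ∈ S [ v ]≔ inside → lab w ∈ L
    S′⊆L w∈ with ∈-[]≔⁻ w∈
    ... | inj₁ refl = v∈L
    ... | inj₂ w∈S  = p─q⊆p L ⁅ lab v ⁆ (S⊆L w∈S)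
    inj′ : ∀ {w x} → w ∈ S [ v ]≔ inside → x ∈ S [ v ]≔ inside → lab w ≡ lab x → w ≡ x
    inj′ w∈ x∈ eq with ∈-[]≔⁻ w∈ | ∈-[]≔⁻ x∈
    ... | inj₁ refl | inj₁ refl = refl
    ... | inj₁ refl | inj₂ x∈S  = contradiction eq (fresh x∈S)
    ... | inj₂ w∈S  | inj₁ refl = contradiction (sym eq) (fresh w∈S)
    ... | inj₂ w∈S  | inj₂ x∈S  = inj w∈S x∈S eq

  module Classical (em : ExcludedMiddle 0ℓ) where

    -- Edge sets of a `KGraph` are Boolean functions, so a property such as `Cyclic` becomes an edge
    -- set through excluded middle.
    decide : Set → Bool
    decide P = ⌊ em {P} ⌋

    decide⁺ : ∀ {P} → P → T (decide P)
    decide⁺ {P} = fromWitness {a? = em {P}}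

    decide⁻ : ∀ {P} → T (decide P) → P
    decide⁻ {P} = toWitness {a? = em {P}}

    -- Choose the vertices one after another. As `c + r ≤ ∣ L ∣`, at least `c` labels of `L` are
    -- still free at each choice, each carried by `t` vertices, and every set arises in `r !`
    -- orders. The hypothesis on sums says that all fibres of `lab` have `t` elements, in the form
    -- in which the double count `suc*count≡sum` meets it.
    count-rainbow : ∀ {m n t} (lab : Fin n → Fin m) → (∀ f → sum (f ∘ lab) ≡ sum f * t) →
      ∀ r c L → c + r ≤ ∣ L ∣ → (t * c) ^ r ≤ count n r (decide ∘ Rainbow lab L) * r !
    count-rainbow {n = n} lab fibres zero c L _ =
      ≤-reflexive (sym (trans (*-identityʳ _)
        (count-zero n {decide ∘ Rainbow lab L} (decide⁺ {Rainbow lab L ∅} ((λ v∈ → contradiction v∈ ∉⊥) , λ v∈ → contradiction v∈ ∉⊥)))))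
    count-rainbow {n = n} {t} lab fibres (suc r) c L c+r≤ = begin
      t * c * (t * c) ^ r
        ≤⟨ *-monoˡ-≤ ((t * c) ^ r) (*-monoʳ-≤ t (≤-trans (m≤m+n c (suc r)) c+r≤)) ⟩
      t * ∣ L ∣ * (t * c) ^ r
        ≡⟨ cong (_* (t * c) ^ r) (trans (*-comm t ∣ L ∣) (cong (_* t) ∣ L ∣≡sum)) ⟩
      sum (χ ∘ lookup L) * t * (t * c) ^ r
        ≡⟨ cong (_* (t * c) ^ r) (sym (fibres (χ ∘ lookup L))) ⟩
      sum (χ ∘ lookup L ∘ lab) * (t * c) ^ r
        ≡⟨ sym (*-distribʳ-sum ((t * c) ^ r) (χ ∘ lookup L ∘ lab)) ⟩
      sum (λ v → χ (lookup L (lab v)) * (t * c) ^ r)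
        ≤⟨ sum-mono-≤ extensions ⟩
      sum (λ v → ext v * r !)
        ≡⟨ *-distribʳ-sum (r !) ext ⟩
      sum ext * r !
        ≡⟨ cong (_* r !) (sym (suc*count≡sum n r _)) ⟩
      suc r * count n (suc r) (decide ∘ Rainbow lab L) * r !
        ≡⟨ regroup (suc r) (count n (suc r) (decide ∘ Rainbow lab L)) (r !) ⟩
      count n (suc r) (decide ∘ Rainbow lab L) * (suc r * r !) ∎
      where
      open ≤-Reasoning
      regroup : ∀ s x f → s * x * f ≡ x * (s * f)
      regroup = solve-∀
      ext : Fin n → ℕ
      ext v = count n r (λ S → not (lookup S v) ∧ decide (Rainbow lab L (S [ v ]≔ inside)))
      extensions : ∀ v → χ (lookup L (lab v)) * (t * c) ^ r ≤ ext v * r !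
      extensions v with lookup L (lab v) in eq
      ... | outside = z≤n
      ... | inside  = begin
        (t * c) ^ r + 0
          ≡⟨ +-identityʳ _ ⟩
        (t * c) ^ r
          ≤⟨ count-rainbow lab fibres r c (L - lab v) (s≤s⁻¹ (≤-trans (≤-reflexive (sym (+-suc c r)))
               (≤-trans c+r≤ (∣p∣≤1+∣p-x∣ L (lab v))))) ⟩
        count n r (decide ∘ Rainbow lab (L - lab v)) * r !
          ≤⟨ *-monoˡ-≤ (r !) (count-mono n r {p = decide ∘ Rainbow lab (L - lab v)} (λ S _ rb →
               let v∉S , rb′ = Rainbow-extend (lookup⇒[]= (lab v) L eq) (decide⁻ rb)
               in Equivalence.from T-∧ (∉⇒T-not v∉S , decide⁺ rb′))) ⟩
        ext v * r ! ∎
        where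
        ∉⇒T-not : ∀ {S : Subset n} → v ∉ S → T (not (lookup S v))
        ∉⇒T-not {S} v∉S with lookup S v in eq
        ... | outside = _
        ... | inside  = contradiction (lookup⇒[]= v S eq) v∉S

  -- Fibres and preimages of a labelling.

  ∈-tabulate⁺ : ∀ {n} {f : Fin n → Bool} {v} → f v ≡ true → v ∈ tabulate f
  ∈-tabulate⁺ {f = f} {v} eq = lookup⇒[]= v _ (trans (lookup∘tabulate f v) eq)

  ∈-tabulate⁻ : ∀ {n} {f : Fin n → Bool} {v} → v ∈ tabulate f → f v ≡ true
  ∈-tabulate⁻ {f = f} {v} v∈ = trans (sym (lookup∘tabulate f v)) ([]=⇒lookup v∈)

  ∣tabulate∣ : ∀ {n} (f : Fin n → Bool) → ∣ tabulate f ∣ ≡ sum (χ ∘ f)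
  ∣tabulate∣ {n} f = trans ∣ tabulate f ∣≡sum (sum-cong-≗ {n} (cong χ ∘ lookup∘tabulate f))

  <⇒<ᵇ≡true : ∀ {m n} → m < n → (m <ᵇ n) ≡ true
  <⇒<ᵇ≡true = Equivalence.to T-≡ ∘ <⇒<ᵇ

  ≤⇒<ᵇ≡false : ∀ {m n} → n ≤ m → (m <ᵇ n) ≡ false
  ≤⇒<ᵇ≡false {m} {n} n≤m with m <ᵇ n in eq
  ... | false = refl
  ... | true  = contradiction (<ᵇ⇒< m n (Equivalence.from T-≡ eq)) (≤⇒≯ n≤m)

  fibre : ∀ {m n} → (Fin n → Fin m) → Fin m → Subset n
  fibre lab i = tabulate (λ v → does (lab v Finₚ.≟ i))

  preimage : ∀ {m n} → (Fin n → Fin m) → Subset m → Subset n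
  preimage lab L = tabulate (lookup L ∘ lab)

  ∈-fibre⁻ : ∀ {m n} {lab : Fin n → Fin m} {i v} → v ∈ fibre lab i → lab v ≡ i
  ∈-fibre⁻ {lab = lab} {i} {v} v∈ with lab v Finₚ.≟ i | ∈-tabulate⁻ {f = λ v → does (lab v Finₚ.≟ i)} v∈
  ... | yes eq | _  = eq
  ... | no  _  | ()

  ∃-max : ∀ {n} → 0 < n → (f : Fin n → ℕ) → ∃ λ i → ∀ j → f j ≤ f i
  ∃-max {suc zero}    _ f = zero , λ { zero → ≤-refl }
  ∃-max {suc (suc n)} _ f with i , max ← ∃-max z<s (f ∘ suc) with ≤-total (f zero) (f (suc i))
  ... | inj₁ f0≤ = suc i , λ { zero → f0≤ ; (suc j) → max j }
  ... | inj₂ ≤f0 = zero  , λ { zero → ≤-refl ; (suc j) → ≤-trans (max j) ≤f0 }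

  sum-δ : ∀ {m} (f : Fin m → ℕ) x → sum (λ j → f j * χ (does (x Finₚ.≟ j))) ≡ f x
  sum-δ {suc m} f zero = trans
    (cong₂ _+_ (*-identityʳ (f zero))
      (trans (sum-cong-≗ {m} (λ j → *-zeroʳ (f (suc j)))) (sum-zero m)))
    (+-identityʳ (f zero))
  sum-δ {suc m} f (suc x) = trans (cong (_+ sum (λ j → f (suc j) * χ (does (x Finₚ.≟ j)))) (*-zeroʳ (f zero))) (sum-δ (f ∘ suc) x)

  sum-fibres : ∀ {m n} (lab : Fin n → Fin m) (f : Fin m → ℕ) →
    sum (f ∘ lab) ≡ sum (λ i → f i * ∣ fibre lab i ∣)
  sum-fibres {m} {n} lab f = begin
    sum (f ∘ lab)
      ≡⟨ sum-cong-≗ {n} (λ v → sym (sum-δ f (lab v))) ⟩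
    sum (λ v → sum (λ i → f i * δ v i))
      ≡⟨ ∑-comm {n} {m} (λ v i → f i * δ v i) ⟩
    sum (λ i → sum (λ v → f i * δ v i))
      ≡⟨ sum-cong-≗ {m} (λ i → trans (sum-cong-≗ {n} (λ v → *-comm (f i) (δ v i)))
           (trans (*-distribʳ-sum (f i) (λ v → δ v i)) (*-comm (sum (λ v → δ v i)) (f i)))) ⟩
    sum (λ i → f i * sum (λ v → δ v i))
      ≡⟨ sum-cong-≗ {m} (λ i → cong (f i *_) (sym (∣tabulate∣ (λ v → does (lab v Finₚ.≟ i))))) ⟩
    sum (λ i → f i * ∣ fibre lab i ∣) ∎
    where
    open ≡-Reasoning
    δ : Fin n → Fin m → ℕ
    δ v i = χ (does (lab v Finₚ.≟ i))

  -- The circle of sites and its sparse arcs.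

  private
    sum-<ᵇ : ∀ m s → sum {m} (λ j → χ (toℕ j <ᵇ s)) ≡ m ⊓ s
    sum-<ᵇ zero    s       = refl
    sum-<ᵇ (suc m) zero    = trans (sum-<ᵇ m zero) (⊓-zeroʳ m)
    sum-<ᵇ (suc m) (suc s) = cong suc (sum-<ᵇ m s)

    m+n<ᵇo≡m<ᵇo∸n : ∀ m n o → (m + n <ᵇ o) ≡ (m <ᵇ o ∸ n)
    m+n<ᵇo≡m<ᵇo∸n m zero    o       = cong (_<ᵇ o) (+-identityʳ m)
    m+n<ᵇo≡m<ᵇo∸n m (suc n) zero    = cong (_<ᵇ 0) (+-suc m n)
    m+n<ᵇo≡m<ᵇo∸n m (suc n) (suc o) = trans (cong (_<ᵇ suc o) (+-suc m n)) (m+n<ᵇo≡m<ᵇo∸n m n o)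

  module Circle (m a : ℕ) (a<m : a < m) where

    -- The number of u < s with u ≡ j mod m, for j < m and s ≤ 2m.
    laps : ℕ → ℕ → ℕ
    laps j s = χ (j <ᵇ s) + χ (j + m <ᵇ s)

    -- The first alternative is the stretch of the arc before it passes site 0, the second the
    -- stretch after.
    inArc : ℕ → ℕ → Bool
    inArc i j = (not (j <ᵇ suc i) ∧ (j <ᵇ suc (i + a))) ∨ (j + m <ᵇ suc (i + a))

    -- The residues i + 1, …, i + a modulo m.
    arc : Fin m → Subset m
    arc i = tabulate (inArc (toℕ i) ∘ toℕ)

    private
      inArc-cases : ∀ (x y z : Bool) → (x ≡ true → y ≡ true) → (z ≡ true → y ≡ true) →
        (x ≡ false → y ≡ true → z ≡ false) →
        χ y + χ z ≡ χ x + 0 + χ ((not x ∧ y) ∨ z)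
      inArc-cases true  true  z     _ _ _ = refl
      inArc-cases false false false _ _ _ = refl
      inArc-cases false true  false _ _ _ = refl
      inArc-cases true  false z     f _ _ = contradiction (f refl) λ ()
      inArc-cases false false true  _ f _ = contradiction (f refl) λ ()
      inArc-cases false true  true  _ _ f = contradiction (f refl refl) λ ()

      ≡true⇒< : ∀ x y → (x <ᵇ y) ≡ true → x < y
      ≡true⇒< x y = <ᵇ⇒< x y ∘ Equivalence.from T-≡

      ≡false⇒≥ : ∀ x y → (x <ᵇ y) ≡ false → y ≤ x
      ≡false⇒≥ x y eq = ≮⇒≥ λ x<y → contradiction (trans (sym eq) (<⇒<ᵇ≡true x<y)) λ ()

    -- As `a < m`, the arc meets no site twice, so `laps` grows by 0 or 1 along it.
    laps-arc : ∀ i j → i < m → laps j (suc (i + a)) ≡ laps j (suc i) + χ (inArc i j)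
    laps-arc i j i<m = trans
      (inArc-cases (j <ᵇ suc i) (j <ᵇ suc (i + a)) (j + m <ᵇ suc (i + a))
        (λ p → <⇒<ᵇ≡true {j} (<-≤-trans (≡true⇒< j (suc i) p) (s≤s (m≤m+n i a))))
        (λ p → <⇒<ᵇ≡true {j} (≤-<-trans (m≤m+n j m) (≡true⇒< (j + m) (suc (i + a)) p)))
        (λ p _ → ≤⇒<ᵇ≡false {j + m} (+-mono-≤-< (≤-trans (n≤1+n i) (≡false⇒≥ j (suc i) p)) a<m)))
      (cong (λ z → χ (j <ᵇ suc i) + χ z + χ (inArc i j))
        (sym (≤⇒<ᵇ≡false {j + m} (≤-trans i<m (m≤n+m m j)))))

    laps-suc : ∀ i j → i < m → j ≢ i → laps j (suc i) ≡ laps j i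
    laps-suc i j i<m j≢i = cong₂ _+_ (cong χ same) (cong χ (trans
      (≤⇒<ᵇ≡false (≤-trans i<m (m≤n+m m j)))
      (sym (≤⇒<ᵇ≡false (≤-trans (<⇒≤ i<m) (m≤n+m m j))))))
      where
      same : (j <ᵇ suc i) ≡ (j <ᵇ i)
      same with <-cmp j i
      ... | tri< j<i _ _ = trans (<⇒<ᵇ≡true (m≤n⇒m≤1+n j<i)) (sym (<⇒<ᵇ≡true j<i))
      ... | tri≈ _ j≡i _ = contradiction j≡i j≢i
      ... | tri> _ _ i<j = trans (≤⇒<ᵇ≡false i<j) (sym (≤⇒<ᵇ≡false (<⇒≤ i<j)))

    laps-period : ∀ {j s} → j < m → s ≤ m → laps j (s + m) ≡ suc (laps j s)
    laps-period {j} {s} j<m s≤m = trans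
      (cong₂ (λ x y → χ x + χ y)
        (<⇒<ᵇ≡true {j} {s + m} (≤-trans j<m (m≤n+m m s)))
        (trans (m+n<ᵇo≡m<ᵇo∸n j m (s + m)) (cong (j <ᵇ_) (m+n∸n≡m s m))))
      (cong suc (sym (trans
        (cong (λ z → χ (j <ᵇ s) + χ z) (≤⇒<ᵇ≡false {j + m} (≤-trans s≤m (m≤n+m m j))))
        (+-identityʳ _))))

    sum-laps : ∀ s → s ≤ m + m → sum {m} (λ j → laps (toℕ j) s) ≡ s
    sum-laps s s≤2m = begin
      sum {m} (λ j → laps (toℕ j) s)
        ≡⟨ ∑-distrib-+ {m} (λ j → χ (toℕ j <ᵇ s)) (λ j → χ (toℕ j + m <ᵇ s)) ⟩
      sum {m} (λ j → χ (toℕ j <ᵇ s)) + sum {m} (λ j → χ (toℕ j + m <ᵇ s))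
        ≡⟨ cong₂ _+_ (sum-<ᵇ m s)
             (trans (sum-cong-≗ {m} (λ j → cong χ (m+n<ᵇo≡m<ᵇo∸n (toℕ j) m s))) (sum-<ᵇ m (s ∸ m))) ⟩
      m ⊓ s + m ⊓ (s ∸ m)
        ≡⟨ cong (m ⊓ s +_) (m≥n⇒m⊓n≡n (≤-trans (∸-monoˡ-≤ m s≤2m) (≤-reflexive (m+n∸n≡m m m)))) ⟩
      m ⊓ s + (s ∸ m)
        ≡⟨ m⊓n+n∸m≡n m s ⟩
      s ∎
      where open ≡-Reasoning

    i+a≤2m : ∀ (i : Fin m) → suc (toℕ i + a) ≤ m + m
    i+a≤2m i = +-mono-≤ (Finₚ.toℕ<n i) (<⇒≤ a<m)

    -- Summing `laps-arc` over all sites treats arcs that pass site 0 and arcs that do not alike.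
    ∣arc∣ : ∀ i → ∣ arc i ∣ ≡ a
    ∣arc∣ i = +-cancelˡ-≡ (suc (toℕ i)) ∣ arc i ∣ a (begin
      suc (toℕ i) + ∣ arc i ∣
        ≡⟨ cong₂ _+_ (sym (sum-laps (suc (toℕ i)) (≤-trans (s≤s (m≤m+n _ a)) (i+a≤2m i))))
                     (∣tabulate∣ {m} (inArc (toℕ i) ∘ toℕ)) ⟩
      sum {m} (λ j → laps (toℕ j) (suc (toℕ i))) + sum {m} (λ j → χ (inArc (toℕ i) (toℕ j)))
        ≡⟨ sym (∑-distrib-+ {m} _ _) ⟩
      sum {m} (λ j → laps (toℕ j) (suc (toℕ i)) + χ (inArc (toℕ i) (toℕ j)))
        ≡⟨ sum-cong-≗ {m} (λ j → sym (laps-arc (toℕ i) (toℕ j) (Finₚ.toℕ<n i))) ⟩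
      sum {m} (λ j → laps (toℕ j) (suc (toℕ i + a)))
        ≡⟨ sum-laps _ (i+a≤2m i) ⟩
      suc (toℕ i) + a ∎)
      where open ≡-Reasoning

    i∉arc : ∀ i → i ∉ arc i
    i∉arc i i∈ = contradiction (trans (sym (∈-tabulate⁻ {f = inArc (toℕ i) ∘ toℕ} i∈)) false-i) λ ()
      where
      false-i : inArc (toℕ i) (toℕ i) ≡ false
      false-i = cong₂ (λ x y → (not x ∧ (toℕ i <ᵇ suc (toℕ i + a))) ∨ y)
        (<⇒<ᵇ≡true (n<1+n (toℕ i))) (≤⇒<ᵇ≡false (+-monoʳ-< (toℕ i) a<m))

    module _ {g} (lab : Fin g → Fin m) (h : Fin g → ℕ) (0<h : 0 < sum h) where

      private
        -- The term `m + m ∸ s` in place of `- s` adds a constant and keeps `ψ` in ℕ. It is exact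
        -- for `s ≤ m + m`, which covers the ends of all arcs.
        Y ψ : ℕ → ℕ
        Y s = sum (λ w → h w * laps (toℕ (lab w)) s)
        ψ s = m * Y s + sum h * (m + m ∸ s)

        ψ-period : ∀ {s} → s ≤ m → ψ (s + m) ≡ ψ s
        ψ-period {s} s≤m = begin
          m * Y (s + m) + sum h * (m + m ∸ (s + m))
            ≡⟨ cong₂ (λ x y → m * x + sum h * y) Y-period ([m+n]∸[o+n]≡m∸o) ⟩
          m * (sum h + Y s) + sum h * (m ∸ s)
            ≡⟨ regroup m (sum h) (Y s) (m ∸ s) ⟩
          m * Y s + sum h * (m + (m ∸ s))
            ≡⟨ cong (λ x → m * Y s + sum h * x) (sym (+-∸-assoc m s≤m)) ⟩
          m * Y s + sum h * (m + m ∸ s) ∎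
          where
          open ≡-Reasoning
          regroup : ∀ m h y d → m * (h + y) + h * d ≡ m * y + h * (m + d)
          regroup = solve-∀
          [m+n]∸[o+n]≡m∸o : m + m ∸ (s + m) ≡ m ∸ s
          [m+n]∸[o+n]≡m∸o = trans (cong₂ _∸_ (+-comm m m) (+-comm s m)) ([m+n]∸[m+o]≡n∸o m m s)
          Y-period : Y (s + m) ≡ sum h + Y s
          Y-period = trans
            (sum-cong-≗ {g} (λ w → trans (cong (h w *_) (laps-period (Finₚ.toℕ<n (lab w)) s≤m)) (*-suc (h w) _)))
            (∑-distrib-+ {g} h (λ w → h w * laps (toℕ (lab w)) s))

        0<m : 0 < m
        0<m = ≤-<-trans z≤n a<m

        maximum : ∃ λ (i : Fin m) → ∀ s → s ≤ m + m → ψ s ≤ ψ (suc (toℕ i))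
        maximum = i , bound
          where
          max = ∃-max 0<m (ψ ∘ suc ∘ toℕ {m})
          i = proj₁ max
          bound⁺ : ∀ s → s < m → ψ (suc s) ≤ ψ (suc (toℕ i))
          bound⁺ s s<m = subst (λ x → ψ (suc x) ≤ ψ (suc (toℕ i))) (Finₚ.toℕ-fromℕ< s<m)
            (proj₂ max (fromℕ< s<m))
          bound≤m : ∀ s → s ≤ m → ψ s ≤ ψ (suc (toℕ i))
          bound≤m (suc s) s<m = bound⁺ s s<m
          -- The maximum is taken over `1, …, m`; by periodicity the value at 0 is the one at `m`.
          bound≤m zero    _   = subst (_≤ ψ (suc (toℕ i))) (ψ-period z≤n)
            (subst (λ x → ψ x ≤ ψ (suc (toℕ i))) (suc-pred m {{>-nonZero 0<m}})
              (bound⁺ (pred m) (≤-reflexive (suc-pred m {{>-nonZero 0<m}}))))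
          bound : ∀ s → s ≤ m + m → ψ s ≤ ψ (suc (toℕ i))
          bound s s≤2m with ≤-total s m
          ... | inj₁ s≤m = bound≤m s s≤m
          ... | inj₂ m≤s = subst (_≤ ψ (suc (toℕ i)))
            (trans (sym (ψ-period s∸m≤m)) (cong ψ (m∸n+n≡m m≤s))) (bound≤m (s ∸ m) s∸m≤m)
            where
            s∸m≤m : s ∸ m ≤ m
            s∸m≤m = ≤-trans (∸-monoˡ-≤ m s≤2m) (≤-reflexive (m+n∸n≡m m m))

      -- Writing Y for the distribution function of the weights h around the circle and |h| for
      -- their sum, the function m * Y s - |h| * s is m-periodic.  It takes its maximum at the right end
      -- s = i + 1 of a point i of positive weight, and comparing with s = i + 1 + a gives the bound.
      light-arc : ∃ λ w → h w ≢ 0 ×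
        m * sum (λ v → h v * χ (lookup (arc (lab w)) (lab v))) ≤ a * sum h
      light-arc with i , max ← maximum with Finₚ.any? (λ w → ¬? (h w ≟ 0) ×-dec (lab w Finₚ.≟ i))
      ... | yes (w , hw≢0 , refl) = w , hw≢0 , ≤-trans
        (*-monoʳ-≤ m (≤-reflexive (sum-cong-≗ {g} (λ v → cong (λ b → h v * χ b) (lookup∘tabulate _ (lab v))))))
        (+-cancelˡ-≤ (m * Y (suc i′) + sum h * rest) _ _ (begin
          m * Y (suc i′) + sum h * rest + m * X
            ≡⟨ regroup m (Y (suc i′)) (sum h * rest) X ⟩
          m * (Y (suc i′) + X) + sum h * rest
            ≡⟨ cong (λ x → m * x + sum h * rest) (sym Y-arc) ⟩
          ψ (suc (i′ + a))
            ≤⟨ max (suc (i′ + a)) (i+a≤2m (lab w)) ⟩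
          m * Y (suc i′) + sum h * (m + m ∸ suc i′)
            ≡⟨ cong (λ x → m * Y (suc i′) + sum h * x) rest+a ⟩
          m * Y (suc i′) + sum h * (rest + a)
            ≡⟨ regroup′ (m * Y (suc i′)) (sum h) rest a ⟩
          m * Y (suc i′) + sum h * rest + a * sum h ∎))
        where
        open ≤-Reasoning
        i′ rest X : ℕ
        i′ = toℕ (lab w)
        rest = m + m ∸ suc (i′ + a)
        X = sum (λ v → h v * χ (inArc i′ (toℕ (lab v))))
        regroup : ∀ m y r x → m * y + r + m * x ≡ m * (y + x) + r
        regroup = solve-∀
        regroup′ : ∀ y h r a → y + h * (r + a) ≡ y + h * r + a * h
        regroup′ = solve-∀
        rest+a : m + m ∸ suc i′ ≡ rest + a
        rest+a = sym (trans (cong (_+ a) (sym (∸-+-assoc (m + m) (suc i′) a)))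
          (m∸n+n≡m (m+n≤o⇒m≤o∸n a (≤-trans (≤-reflexive (+-comm a (suc i′))) (i+a≤2m (lab w))))))
        Y-arc : Y (suc (i′ + a)) ≡ Y (suc i′) + X
        Y-arc = trans
          (sum-cong-≗ {g} (λ v → trans (cong (h v *_) (laps-arc i′ (toℕ (lab v)) (Finₚ.toℕ<n (lab w))))
            (*-distribˡ-+ (h v) _ _)))
          (∑-distrib-+ {g} (λ v → h v * laps (toℕ (lab v)) (suc i′)) (λ v → h v * χ (inArc i′ (toℕ (lab v)))))
      -- Without weight at site `i`, `Y` does not grow from `i` to `i + 1` while the linear term
      -- drops, so `ψ` would be larger at `i`.
      ... | no none = contradiction (max i′ (<⇒≤ (≤-trans (Finₚ.toℕ<n i) (m≤m+n m m)))) (<⇒≱ (begin-strict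
          m * Y (suc i′) + sum h * (m + m ∸ suc i′)
            <⟨ +-monoʳ-< (m * Y (suc i′)) (*-monoʳ-< (sum h) {{>-nonZero 0<h}}
                 (∸-monoʳ-< {m + m} (n<1+n i′) (≤-trans (Finₚ.toℕ<n i) (m≤m+n m m)))) ⟩
          m * Y (suc i′) + sum h * (m + m ∸ i′)
            ≡⟨ cong (λ x → m * x + sum h * (m + m ∸ i′)) (sum-cong-≗ {g} same) ⟩
          ψ i′ ∎))
        where
        open ≤-Reasoning
        i′ = toℕ i
        same : ∀ w → h w * laps (toℕ (lab w)) (suc i′) ≡ h w * laps (toℕ (lab w)) i′
        same w with h w ≟ 0
        ... | yes hw≡0 rewrite hw≡0 = refl
        ... | no  hw≢0 = cong (h w *_) (laps-suc i′ (toℕ (lab w)) (Finₚ.toℕ<n i)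
          (λ eq → none (w , hw≢0 , Finₚ.toℕ-injective eq)))

    module _ {g} ℓ (lab : Fin g → Fin m) (g-large : m * (m * ℓ) < g) where

      open ≤-Reasoning

      private
        isHeavy : Fin m → Bool
        isHeavy i = ℓ ≤ᵇ ∣ fibre lab i ∣
        h light : Fin g → ℕ
        h v = χ (isHeavy (lab v))
        light v = χ (not (isHeavy (lab v)))
        split : ∀ b x → x ≤ 1 → x ≤ χ b * x + χ (not b)
        split true  x _   = ≤-reflexive (sym (trans (+-identityʳ _) (+-identityʳ x)))
        split false x x≤1 = x≤1
        light≤ : sum light ≤ m * ℓ
        light≤ = begin
          sum light
            ≡⟨ sum-fibres lab (χ ∘ not ∘ isHeavy) ⟩
          sum (λ i → χ (not (isHeavy i)) * ∣ fibre lab i ∣)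
            ≤⟨ sum-mono-≤ {m} small ⟩
          sum {m} (λ _ → ℓ)
            ≡⟨ sum-const m ℓ ⟩
          m * ℓ ∎
          where
          small : ∀ i → χ (not (isHeavy i)) * ∣ fibre lab i ∣ ≤ ℓ
          small i with ≤-total ℓ ∣ fibre lab i ∣
          ... | inj₁ ℓ≤ rewrite Equivalence.to T-≡ (≤⇒≤ᵇ ℓ≤) = z≤n
          ... | inj₂ ≤ℓ = ≤-trans (*-monoˡ-≤ ∣ fibre lab i ∣ (χ≤1 (not (isHeavy i)))) (≤-trans (≤-reflexive (+-identityʳ _)) ≤ℓ)
        total : sum h + sum light ≡ g
        total = trans (sym (∑-distrib-+ {g} h light))
          (trans (sum-cong-≗ {g} (λ v → one (isHeavy (lab v)))) (trans (sum-const g 1) (*-identityʳ g)))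
          where
          one : ∀ b → χ b + χ (not b) ≡ 1
          one true  = refl
          one false = refl
        h≤g : sum h ≤ g
        h≤g = ≤-trans (m≤m+n (sum h) (sum light)) (≤-reflexive total)
        0<h : 0 < sum h
        0<h = +-cancelʳ-< (sum light) 0 (sum h) (begin-strict
          sum light        ≤⟨ light≤ ⟩
          m * ℓ            ≤⟨ m≤n*m (m * ℓ) m {{>-nonZero (≤-<-trans z≤n a<m)}} ⟩
          m * (m * ℓ)      <⟨ g-large ⟩
          g                ≡⟨ sym total ⟩
          sum h + sum light ∎)
        heavy : ∀ {v} → h v ≢ 0 → ℓ ≤ ∣ fibre lab (lab v) ∣
        heavy {v} hv≢0 with isHeavy (lab v) in eq
        ... | true  = ≤ᵇ⇒≤ ℓ _ (Equivalence.from T-≡ eq)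
        ... | false = contradiction refl hv≢0

      -- Apply `light-arc` with weight 1 on the vertices at sites with at least `ℓ` vertices. The
      -- vertices left out number at most `m * ℓ`, and `m` times this is below `g` by `g-large`;
      -- they are paid for by passing from `a` to `suc a`.
      sparse-arc : ∃ λ i → ℓ ≤ ∣ fibre lab i ∣ × m * ∣ preimage lab (arc i) ∣ ≤ suc a * g
      sparse-arc with w , hw≢0 , m*≤ ← light-arc lab h 0<h =
        lab w , heavy hw≢0 , (begin
          m * ∣ preimage lab (arc (lab w)) ∣
            ≡⟨ cong (m *_) (∣tabulate∣ (lookup (arc (lab w)) ∘ lab)) ⟩
          m * sum (λ v → X v)
            ≤⟨ *-monoʳ-≤ m (≤-trans (sum-mono-≤ (λ v → split (isHeavy (lab v)) (X v) (χ≤1 _)))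
                 (≤-reflexive (∑-distrib-+ {g} (λ v → h v * X v) light))) ⟩
          m * (sum (λ v → h v * X v) + sum light)
            ≡⟨ *-distribˡ-+ m _ (sum light) ⟩
          m * sum (λ v → h v * X v) + m * sum light
            ≤⟨ +-mono-≤ m*≤ (*-monoʳ-≤ m light≤) ⟩
          a * sum h + m * (m * ℓ)
            ≤⟨ +-mono-≤ (*-monoʳ-≤ a h≤g) (<⇒≤ g-large) ⟩
          a * g + g
            ≡⟨ +-comm (a * g) g ⟩
          suc a * g ∎)
        where
        X : Fin g → ℕ
        X v = χ (lookup (arc (lab w)) (lab v))

  -- Graphs on more than M vertices whose minimum ℓ-degree exceeds (B / m) ^ (k ∸ ℓ) times its
  -- largest conceivable value.
  Dense : ∀ {k} → (ℓ M B m : ℕ) → Family k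
  Dense {k} ℓ M B m g G =
    M < g × B ^ (k ∸ ℓ) * (g C (k ∸ ℓ)) < m ^ (k ∸ ℓ) * minDegree ℓ G

  -- The circular graph: its minimum degree and its large subgraphs.

  module Construction (em : ExcludedMiddle 0ℓ) (k ℓ m a : ℕ)
    (2≤ℓ : 2 ≤ ℓ) (ℓ≤k : ℓ ≤ k) (a+ℓ≤m : a + ℓ ≤ m) where

    open Classical em

    private
      r : ℕ
      r = k ∸ ℓ

      r+ℓ≡k : r + ℓ ≡ k
      r+ℓ≡k = m∸n+n≡m ℓ≤k

      a<m : a < m
      a<m = <-≤-trans (m<m+n a (≤-trans z<s 2≤ℓ)) a+ℓ≤m

    open Circle m a a<m

    -- Phrased with injections from `Fin ℓ` rather than `ℓ`-subsets, so that it pulls back along an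
    -- embedding by composition. Since `i ∉ arc i`, such a set has at most `ℓ` vertices at any site.
    Cyclic : ∀ {n} → (Fin n → Fin m) → Subset n → Set
    Cyclic {n} lab S = ∀ i (u : Fin ℓ → Fin n) → Injective _≡_ _≡_ u →
      (∀ j → u j ∈ S × lab (u j) ≡ i) → ∀ v → v ∈ S → (∀ j → u j ≢ v) → lab v ∈ arc i

    cyclicGraph : ∀ {n} → (Fin n → Fin m) → KGraph k n
    cyclicGraph lab = mkKGraph (λ S → (∣ S ∣ ≡ᵇ k) ∧ decide (Cyclic lab S))
      (λ S S∈ → ≡ᵇ⇒≡ ∣ S ∣ k (proj₁ (Equivalence.to T-∧ S∈)))

    Cyclic-image : ∀ {g n} (lab : Fin n → Fin m) (f : Fin g → Fin n) → Injective _≡_ _≡_ f →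
      ∀ {S} → Cyclic lab (image f S) → Cyclic (lab ∘ f) S
    Cyclic-image lab f f-inj cyc i u u-inj u∈ v v∈S v∉u =
      cyc i (f ∘ u) (u-inj ∘ f-inj) (λ j → let uj∈S , eq = u∈ j in ∈-image f uj∈S , eq)
        (f v) (∈-image f v∈S) (λ j → v∉u j ∘ f-inj)

    module _ {n} {lab : Fin n → Fin m} where

      -- Any `ℓ` vertices of `S ∪ U` at one site must be `U` itself: the site lies outside `L`, so
      -- none of them is in `S`, and `U` has only `ℓ` elements. What remains to check is the last
      -- hypothesis.
      Cyclic-∪ : ∀ {L S U} → ∣ U ∣ ≡ ℓ → Rainbow lab L S → (∀ v → v ∈ U → lab v ∉ L) →
        (∀ i → (∀ v → v ∈ U → lab v ≡ i) → ∀ {j} → j ∈ L → j ∈ arc i) → Cyclic lab (S ∪ U)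
      Cyclic-∪ {L} {S} {U} ∣U∣≡ℓ (S⊆L , S-inj) avoid mono i u u-inj u∈ v v∈ v∉u =
        mono i U-mono (v∈L (x∈p∪q⁻ S U v∈))
        where
        i∈L⇒u∈S : i ∈ L → ∀ j → u j ∈ S
        i∈L⇒u∈S i∈L j with x∈p∪q⁻ S U (proj₁ (u∈ j))
        ... | inj₁ uj∈S = uj∈S
        ... | inj₂ uj∈U = contradiction (subst (_∈ L) (sym (proj₂ (u∈ j))) i∈L) (avoid (u j) uj∈U)

        -- A rainbow S cannot contain two vertices labelled i, and ℓ ≥ 2.
        i∉L : i ∉ L
        i∉L i∈L = contradiction (cong toℕ (u-inj (S-inj (u∈S j₀) (u∈S j₁)
            (trans (proj₂ (u∈ j₀)) (sym (proj₂ (u∈ j₁)))))))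
          (λ eq → case trans (sym (Finₚ.toℕ-fromℕ< _)) (trans eq (Finₚ.toℕ-fromℕ< _)) of λ ())
          where
          u∈S = i∈L⇒u∈S i∈L
          j₀ j₁ : Fin ℓ
          j₀ = fromℕ< {0} (≤-trans z<s 2≤ℓ)
          j₁ = fromℕ< {1} 2≤ℓ

        u∈U : ∀ j → u j ∈ U
        u∈U j with x∈p∪q⁻ S U (proj₁ (u∈ j))
        ... | inj₂ uj∈U = uj∈U
        ... | inj₁ uj∈S = contradiction (subst (_∈ L) (proj₂ (u∈ j)) (S⊆L uj∈S)) i∉L

        U-covered : ∀ {w} → w ∈ U → ¬ (∀ j → u j ≢ w)
        U-covered = injective⇒covers U ∣U∣≡ℓ u u-inj u∈U

        v∈L : v ∈ S ⊎ v ∈ U → lab v ∈ L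
        v∈L (inj₁ v∈S) = S⊆L v∈S
        v∈L (inj₂ v∈U) = contradiction v∉u (U-covered v∈U)

        U-mono : ∀ w → w ∈ U → lab w ≡ i
        U-mono w w∈U = decidable-stable (lab w Finₚ.≟ i) λ lw≢i →
          U-covered w∈U λ j uj≡w → lw≢i (trans (cong lab (sym uj≡w)) (proj₂ (u∈ j)))

      rainbow-labels : ∀ U → ∣ U ∣ ≡ ℓ → ∃ λ L → a ≤ ∣ L ∣ × (∀ v → v ∈ U → lab v ∉ L) ×
        (∀ i → (∀ v → v ∈ U → lab v ≡ i) → ∀ {j} → j ∈ L → j ∈ arc i)
      rainbow-labels U ∣U∣≡ℓ with em {∃ λ i → ∀ v → v ∈ U → lab v ≡ i}
      ... | yes (i , U-mono) = arc i , ≤-reflexive (sym (∣arc∣ i)) ,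
        (λ v v∈U → subst (_∉ arc i) (sym (U-mono v v∈U)) (i∉arc i)) ,
        (λ i′ U-mono′ → subst (λ x → _ ∈ arc x)
          (let u , _ , u∈U = enumerate-ofSize U ∣U∣≡ℓ
               j = fromℕ< {0} (≤-trans z<s 2≤ℓ)
           in trans (sym (U-mono _ (u∈U j))) (U-mono′ _ (u∈U j))))
      -- At least `m - ℓ` labels are free, and `a + ℓ ≤ m`; the condition on the arc is vacuous.
      ... | no ¬mono with L , m≤ , avoid ← ∃-avoiding lab U = L ,
        +-cancelʳ-≤ ℓ a ∣ L ∣ (≤-trans a+ℓ≤m (≤-trans m≤ (≤-reflexive (cong (∣ L ∣ +_) ∣U∣≡ℓ)))) ,
        avoid , λ i U-mono → contradiction (i , U-mono) ¬mono

      degree-cyclicGraph : ∀ {t c} → (∀ f → sum (f ∘ lab) ≡ sum f * t) → c + r ≤ a →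
        ∀ U → ∣ U ∣ ≡ ℓ → (t * c) ^ r ≤ degree ℓ (cyclicGraph lab) U * r !
      degree-cyclicGraph {t} {c} fibres c+r≤a U ∣U∣≡ℓ
        with L , a≤ , avoid , mono ← rainbow-labels U ∣U∣≡ℓ = begin
        (t * c) ^ r
          ≤⟨ count-rainbow lab fibres r c L (≤-trans c+r≤a a≤) ⟩
        count n r (decide ∘ Rainbow lab L) * r !
          ≤⟨ *-monoˡ-≤ (r !) (count-mono n r {decide ∘ Rainbow lab L} (λ S ∣S∣≡r rb →
               let S⊆L , S-inj = decide⁻ {Rainbow lab L S} rb in
               Equivalence.from T-∧
                 (≡⇒≡ᵇ ∣ S ∪ U ∣ k (∣S∪U∣≡k S ∣S∣≡r (λ x x∈S x∈U → avoid x x∈U (S⊆L x∈S)))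
                 , decide⁺ (Cyclic-∪ {L} ∣U∣≡ℓ (S⊆L , S-inj) avoid mono)))) ⟩
        count n r (λ S → edge (cyclicGraph lab) (S ∪ U)) * r !
          ≡⟨ cong (_* r !) (sym (degree≡count ℓ (cyclicGraph lab) U)) ⟩
        degree ℓ (cyclicGraph lab) U * r ! ∎
        where
        open ≤-Reasoning
        ∣S∪U∣≡k : ∀ S → ∣ S ∣ ≡ r → (∀ x → x ∈ S → x ∉ U) → ∣ S ∪ U ∣ ≡ k
        ∣S∪U∣≡k S ∣S∣≡r dis = trans (sym (+-identityʳ _))
          (trans (cong (∣ S ∪ U ∣ +_) (sym (disjoint⇒∣p∩q∣≡0 S U dis)))
          (trans (∣p∪q∣+∣p∩q∣≡∣p∣+∣q∣ S U) (trans (cong₂ _+_ ∣S∣≡r ∣U∣≡ℓ) r+ℓ≡k)))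

      minDegree-cyclicGraph : ∀ {t c} → (∀ f → sum (f ∘ lab) ≡ sum f * t) → c + r ≤ a → ℓ ≤ n →
        (t * c) ^ r ≤ minDegree ℓ (cyclicGraph lab) * r !
      minDegree-cyclicGraph fibres c+r≤a ℓ≤n =
        minDegree-all {P = λ d → _ ≤ d * r !} (cyclicGraph lab) ℓ≤n (degree-cyclicGraph fibres c+r≤a)

      -- Any `ℓ`-set `U` over site `i` is a witness: an edge of `G` through `U` goes to an edge with
      -- `ℓ` vertices at `i`, so its other vertices lie over the arc.
      minDegree-≤-arc : ∀ {g} (G : KGraph k g) → (copy : Contains (cyclicGraph lab) G) → let f = proj₁ copy in
        ∀ i → ℓ ≤ ∣ fibre (lab ∘ f) i ∣ → minDegree ℓ G ≤ ∣ preimage (lab ∘ f) (arc i) ∣ C r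
      minDegree-≤-arc {g} G (f , f-inj , f-edge) i ℓ≤fibre
        with U , U⊆fibre , ∣U∣≡ℓ ← ∃-⊆-ofSize (fibre (lab ∘ f) i) ℓ ℓ≤fibre
        with u , u-inj , u∈U ← enumerate-ofSize U ∣U∣≡ℓ = begin
          minDegree ℓ G
            ≤⟨ minDegree-≤ G U ∣U∣≡ℓ ⟩
          degree ℓ G U
            ≡⟨ degree≡count ℓ G U ⟩
          count g r (λ S → edge G (S ∪ U))
            -- `count-⊆-≤` speaks of sets of every size, so the size is made part of the predicate.
            ≤⟨ count-mono g r (λ S ∣S∣≡r S∪U∈G → Equivalence.from T-∧ (≡⇒≡ᵇ ∣ S ∣ r ∣S∣≡r , S∪U∈G)) ⟩
          count g r (λ S → (∣ S ∣ ≡ᵇ r) ∧ edge G (S ∪ U))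
            ≤⟨ count-⊆-≤ g r X link⊆X ⟩
          ∣ X ∣ C r ∎
        where
        open ≤-Reasoning
        X : Subset g
        X = preimage (lab ∘ f) (arc i)

        link⊆X : ∀ S → T ((∣ S ∣ ≡ᵇ r) ∧ edge G (S ∪ U)) → S ⊆ X
        link⊆X S S∈ {v} v∈S = ∈-tabulate⁺ {f = lookup (arc i) ∘ lab ∘ f} ([]=⇒lookup
          (Cyclic-image lab f f-inj
            (decide⁻ (proj₂ (Equivalence.to (T-∧ {∣ image f (S ∪ U) ∣ ≡ᵇ k}) (f-edge (S ∪ U) S∪U∈G))))
            i u u-inj (λ j → x∈p∪q⁺ (inj₂ (u∈U j)) , ∈-fibre⁻ {lab = lab ∘ f} (U⊆fibre (u∈U j)))
            v (x∈p∪q⁺ (inj₁ v∈S)) (λ j uj≡v → v∉U (subst (_∈ U) uj≡v (u∈U j)))))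
          where
          ∣S∣≡r = ≡ᵇ⇒≡ ∣ S ∣ r (proj₁ (Equivalence.to T-∧ S∈))
          S∪U∈G = proj₂ (Equivalence.to (T-∧ {∣ S ∣ ≡ᵇ r}) S∈)
          -- `degree` does not ask for disjoint sets; disjointness follows since the edge `S ∪ U`
          -- has `k = r + ℓ` elements.
          ∣S∩U∣≡0 : ∣ S ∩ U ∣ ≡ 0
          ∣S∩U∣≡0 = +-cancelˡ-≡ k ∣ S ∩ U ∣ 0 (trans (cong (_+ ∣ S ∩ U ∣) (sym (uniform G (S ∪ U) S∪U∈G)))
            (trans (∣p∪q∣+∣p∩q∣≡∣p∣+∣q∣ S U)
            (trans (cong₂ _+_ ∣S∣≡r ∣U∣≡ℓ) (trans r+ℓ≡k (sym (+-identityʳ k))))))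
          v∉U : v ∉ U
          v∉U v∈U = contradiction (x∈p⇒0<∣p∣ (x∈p∩q⁺ (v∈S , v∈U))) (≤⇒≯ (≤-reflexive ∣S∩U∣≡0))

      cyclicGraph-free : Free (Dense {k} ℓ (m * (m * ℓ)) (suc a) m) (cyclicGraph lab)
      cyclicGraph-free g G (g-large , G-dense) copy =
        let i , ℓ≤fibre , m*X≤ = sparse-arc ℓ (lab ∘ proj₁ copy) g-large
        in contradiction G-dense (≤⇒≯ (m^k*d≤b^k*nCk r (≤-<-trans z≤n g-large) (∣p∣≤n (preimage (lab ∘ proj₁ copy) (arc i))) m*X≤
             (minDegree-≤-arc G copy i ℓ≤fibre)))

-- Rational arithmetic, and rational intervals above a real number.

module Limsup where

  open import Data.Integer as ℤ using ()
  import Data.Integer.Properties as ℤₚ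
  import Data.Integer.Solver as ℤSolver
  open import Data.Nat as ℕ using (ℕ; zero; suc; z≤n; s≤s)
  import Data.Nat.Properties as ℕₚ
  open import Data.Rational using (ℚ; mkℚ; 0ℚ; 1ℚ; ½; _/_; _+_; _-_; -_; _*_; _≤_; _<_; *<*; ∣_∣; toℚᵘ)
  open import Data.Rational.Properties
  open import Data.Rational.Solver using (module +-*-Solver)
  import Data.Rational.Unnormalised as ℚᵘ
  import Data.Rational.Unnormalised.Properties as ℚᵘₚ
  open import Relation.Nullary.Decidable using (decidable-stable)
  open +-*-Solver using (solve; _:+_; _:-_; :-_; _:=_)

  /-mono-≤ : ∀ a b c d → a ℕ.* suc d ℕ.≤ c ℕ.* suc b → (ℤ.+ a) / suc b ≤ (ℤ.+ c) / suc d
  /-mono-≤ a b c d ad≤cb = toℚᵘ-cancel-≤ (begin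
    toℚᵘ ((ℤ.+ a) / suc b)   ≃⟨ toℚᵘ-fromℚᵘ (ℚᵘ.mkℚᵘ (ℤ.+ a) b) ⟩
    ℚᵘ.mkℚᵘ (ℤ.+ a) b        ≤⟨ ℚᵘ.*≤* (subst₂ ℤ._≤_ (ℤₚ.pos-* a (suc d)) (ℤₚ.pos-* c (suc b)) (ℤ.+≤+ ad≤cb)) ⟩
    ℚᵘ.mkℚᵘ (ℤ.+ c) d        ≃⟨ toℚᵘ-fromℚᵘ (ℚᵘ.mkℚᵘ (ℤ.+ c) d) ⟨
    toℚᵘ ((ℤ.+ c) / suc d)   ∎)
    where open ℚᵘₚ.≤-Reasoning

  δ : ℕ → ℚ
  δ n = (ℤ.+ 1) / suc n

  δ-anti-mono : ∀ {m n} → m ℕ.≤ n → δ n ≤ δ m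
  δ-anti-mono {m} {n} m≤n = /-mono-≤ 1 n 1 m (ℕₚ.*-monoʳ-≤ 1 (s≤s m≤n))

  archimedean : ∀ {ε} → 0ℚ < ε → ∃ λ n → δ n ≤ ε
  archimedean {mkℚ (ℤ.+ zero) d c} (*<* (ℤ.+<+ ()))
  archimedean {mkℚ (ℤ.+ suc p) d c} _ = d , subst (δ d ≤_) (↥p/↧p≡p (mkℚ (ℤ.+ suc p) d c))
    (/-mono-≤ 1 d (suc p) d (ℕₚ.*-monoˡ-≤ (suc d) (s≤s {0} {p} z≤n)))
  archimedean {mkℚ ℤ.-[1+ p ] d c} (*<* ())

  [1+c]/d≡c/d+δ : ∀ c d → (ℤ.+ suc c) / suc d ≡ (ℤ.+ c) / suc d + δ d
  [1+c]/d≡c/d+δ c d = toℚᵘ-injective (begin-equality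
    toℚᵘ ((ℤ.+ suc c) / suc d)                  ≃⟨ toℚᵘ-fromℚᵘ (ℚᵘ.mkℚᵘ (ℤ.+ suc c) d) ⟩
    ℚᵘ.mkℚᵘ (ℤ.+ suc c) d                       ≃⟨ ℚᵘ.*≡* (split (ℤ.+ c) (ℤ.+ suc d)) ⟩
    ℚᵘ.mkℚᵘ (ℤ.+ c) d ℚᵘ.+ ℚᵘ.mkℚᵘ (ℤ.+ 1) d    ≃⟨ ℚᵘₚ.+-cong (toℚᵘ-fromℚᵘ (ℚᵘ.mkℚᵘ (ℤ.+ c) d))
                                                            (toℚᵘ-fromℚᵘ (ℚᵘ.mkℚᵘ (ℤ.+ 1) d)) ⟨
    toℚᵘ ((ℤ.+ c) / suc d) ℚᵘ.+ toℚᵘ (δ d)       ≃⟨ toℚᵘ-homo-+ ((ℤ.+ c) / suc d) (δ d) ⟨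
    toℚᵘ ((ℤ.+ c) / suc d + δ d)                 ∎)
    where
    open ℚᵘₚ.≤-Reasoning
    open ℤSolver.+-*-Solver using () renaming (solve to solveℤ; _:+_ to _⊕_; _:*_ to _⊗_; _:=_ to _⊜_; con to κ)
    split : ∀ c D → (ℤ.+ 1 ℤ.+ c) ℤ.* (D ℤ.* D) ≡ (c ℤ.* D ℤ.+ ℤ.+ 1 ℤ.* D) ℤ.* D
    split = solveℤ 2 (λ c D → (κ (ℤ.+ 1) ⊕ c) ⊗ (D ⊗ D) ⊜ (c ⊗ D ⊕ κ (ℤ.+ 1) ⊗ D) ⊗ D) refl

  ∃-half : ∀ {ε} → 0ℚ < ε → ∃ λ η → 0ℚ < η × η + η ≡ ε
  ∃-half {ε} 0<ε = ½ * ε , subst (_< ½ * ε) (*-zeroʳ ½) (*-monoʳ-<-pos ½ 0<ε) ,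
    trans (sym (*-distribʳ-+ ε ½ ½)) (*-identityˡ ε)

  ∃-eighth : ∀ {ε} → 0ℚ < ε → ∃ λ η → 0ℚ < η × η + η + η + η + η + η + η + η ≡ ε
  ∃-eighth 0<ε with x , 0<x , refl ← ∃-half 0<ε with y , 0<y , refl ← ∃-half 0<x
               with z , 0<z , refl ← ∃-half 0<y = z , 0<z , regroup z
    where
    regroup : ∀ z → z + z + z + z + z + z + z + z ≡ z + z + (z + z) + (z + z + (z + z))
    regroup = solve 1 (λ z → z :+ z :+ z :+ z :+ z :+ z :+ z :+ z
      := z :+ z :+ (z :+ z) :+ (z :+ z :+ (z :+ z))) refl

  ∣p-q∣<ε : ∀ p q {ε} → p < q + ε → q < p + ε → ∣ p - q ∣ < ε
  ∣p-q∣<ε p q {ε} p<q+ε q<p+ε with ∣p∣≡p∨∣p∣≡-p (p - q)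
  ... | inj₁ eq = subst₂ _<_ (sym eq) (solve 2 (λ q e → q :+ e :- q := e) refl q ε) (+-monoˡ-< (- q) p<q+ε)
  ... | inj₂ eq = subst₂ _<_ (trans (solve 2 (λ p q → q :- p := :- (p :- q)) refl p q) (sym eq))
    (solve 2 (λ p e → p :+ e :- p := e) refl p ε) (+-monoˡ-< (- p) q<p+ε)

  ∣p-q∣<ε⇒p<q+ε : ∀ p q {ε} → ∣ p - q ∣ < ε → p < q + ε
  ∣p-q∣<ε⇒p<q+ε p q {ε} ∣p-q∣<ε = subst (_< q + ε)
    (solve 2 (λ p q → q :+ (p :- q) := p) refl p q) (+-monoʳ-< q (≤-<-trans (p≤∣p∣ (p - q)) ∣p-q∣<ε))
    where
    p≤∣p∣ : ∀ p → p ≤ ∣ p ∣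
    p≤∣p∣ p with ≤-total 0ℚ p
    ... | inj₁ 0≤p = ≤-reflexive (sym (0≤p⇒∣p∣≡p 0≤p))
    ... | inj₂ p≤0 = ≤-trans p≤0 (0≤∣p∣ p)

  x+e+e+e≡x+[e+e+e] : ∀ x e → x + e + e + e ≡ x + (e + e + e)
  x+e+e+e≡x+[e+e+e] = solve 2 (λ x e → x :+ e :+ e :+ e := x :+ (e :+ e :+ e)) refl

  p≤p+q : ∀ p {q} → 0ℚ ≤ q → p ≤ p + q
  p≤p+q p {q} 0≤q = subst (_≤ p + q) (+-identityʳ p) (+-monoʳ-≤ p 0≤q)

  +-cancelʳ-≤ : ∀ r {p q} → p + r ≤ q + r → p ≤ q
  +-cancelʳ-≤ r {p} {q} p+r≤q+r = subst₂ _≤_ (cancel p) (cancel q) (+-monoˡ-≤ (- r) p+r≤q+r)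
    where
    cancel : ∀ x → x + r - r ≡ x
    cancel x = solve 2 (λ x r → x :+ r :- r := x) refl x r

  ∃-below : ∀ {ε₁ ε₂} → 0ℚ < ε₁ → 0ℚ < ε₂ → ∃ λ ε → 0ℚ < ε × ε ≤ ε₁ × ε ≤ ε₂
  ∃-below {ε₁} {ε₂} 0<ε₁ 0<ε₂ with ≤-total ε₁ ε₂
  ... | inj₁ ε₁≤ε₂ = ε₁ , 0<ε₁ , ≤-refl , ε₁≤ε₂
  ... | inj₂ ε₂≤ε₁ = ε₂ , 0<ε₂ , ε₂≤ε₁ , ≤-refl

  -- An interval from `u` to `w` inside the target, with room to spare. Below `u` there are two
  -- margins `η`: the lower bound on a density is only known as `u < x + η`, which uses one, and the
  -- other witnesses `α <ʳ x`.
  RationalGap : ℝ → ℝ → Set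
  RationalGap α d =
    ∃ λ u → ∃ λ w → ∃ λ η → 0ℚ ≤ u × u < w × 0ℚ < η × w + η ≤ 1ℚ ×
      ∃ λ N → ∀ n → N ℕ.≤ n → seq α n + η + η ≤ u × w + η ≤ seq α n + seq d n

  rational-gap : ∀ α d → α ∈[0,1⟩ → 0ʳ <ʳ d → RationalGap α d
  rational-gap α d (0≤α , ε₁ , 0<ε₁ , N₁ , α<1) (ε₂ , 0<ε₂ , N₂ , 0<d)
    with ε , 0<ε , ε≤ε₁ , ε≤ε₂ ← ∃-below 0<ε₁ 0<ε₂
    with η , 0<η , 8η≡ε ← ∃-eighth 0<ε
    with N₃ , close ← cauchy α η 0<η =
    -- Eventually `α` stays within `η` of `p`. So `u` exceeds `α` by at least `2η`, and `w + η`
    -- exceeds it by at most `6η`, less than `ε = 8η`.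
    p + (η + η + η) , p + (η + η + η + η) , η , 0≤u ,
    +-monoʳ-< p (subst (_< η + η + η + η) (+-identityʳ _) (+-monoʳ-< (η + η + η) 0<η)) , 0<η ,
    w≤ N ℕₚ.≤-refl (≤-trans (+-monoʳ-≤ (seq α N) ε≤ε₁) (α<1 N (N₁≤ ℕₚ.≤-refl))) ,
    N , λ n N≤n →
      (begin
        seq α n + η + η          ≤⟨ +-monoˡ-≤ η (+-monoˡ-≤ η (<⇒≤ (∣p-q∣<ε⇒p<q+ε (seq α n) p (close n N₃ (N₃≤ N≤n) ℕₚ.≤-refl)))) ⟩
        p + η + η + η            ≡⟨ x+e+e+e≡x+[e+e+e] p η ⟩
        p + (η + η + η)          ∎) ,
      w≤ n N≤n (+-monoʳ-≤ (seq α n) (≤-trans ε≤ε₂ (subst (_≤ seq d n) (+-identityˡ ε₂) (0<d n (N₂≤ N≤n)))))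
    where
    open ≤-Reasoning
    p = seq α N₃
    N = N₁ ℕ.⊔ N₂ ℕ.⊔ N₃
    N₃≤ : ∀ {n} → N ℕ.≤ n → N₃ ℕ.≤ n
    N₃≤ = ℕₚ.m⊔n≤o⇒n≤o (N₁ ℕ.⊔ N₂) N₃
    N₁≤ : ∀ {n} → N ℕ.≤ n → N₁ ℕ.≤ n
    N₁≤ = ℕₚ.m⊔n≤o⇒m≤o N₁ N₂ ∘ ℕₚ.m⊔n≤o⇒m≤o (N₁ ℕ.⊔ N₂) N₃
    N₂≤ : ∀ {n} → N ℕ.≤ n → N₂ ℕ.≤ n
    N₂≤ = ℕₚ.m⊔n≤o⇒n≤o N₁ N₂ ∘ ℕₚ.m⊔n≤o⇒m≤o (N₁ ℕ.⊔ N₂) N₃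
    w≤ : ∀ n → N ℕ.≤ n → ∀ {b} → seq α n + ε ≤ b → p + (η + η + η + η) + η ≤ b
    w≤ n N≤n {b} α+ε≤b = begin
      p + (η + η + η + η) + η
        ≤⟨ +-monoˡ-≤ η (+-monoˡ-≤ (η + η + η + η) (<⇒≤ (∣p-q∣<ε⇒p<q+ε p (seq α n) (close N₃ n ℕₚ.≤-refl (N₃≤ N≤n))))) ⟩
      seq α n + η + (η + η + η + η) + η
        ≤⟨ ≤-trans (p≤p+q _ {η} (<⇒≤ 0<η)) (p≤p+q _ {η} (<⇒≤ 0<η)) ⟩
      seq α n + η + (η + η + η + η) + η + η + η
        ≡⟨ solve 2 (λ x e → x :+ e :+ (e :+ e :+ e :+ e) :+ e :+ e :+ e
                         := x :+ (e :+ e :+ e :+ e :+ e :+ e :+ e :+ e)) refl (seq α n) η ⟩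
      seq α n + (η + η + η + η + η + η + η + η)
        ≡⟨ cong (seq α n +_) 8η≡ε ⟩
      seq α n + ε
        ≤⟨ α+ε≤b ⟩
      b ∎
    0≤u : 0ℚ ≤ p + (η + η + η)
    0≤u = ≮⇒≥ λ u<0 → 0≤α (η , 0<η , N₃ , λ n N₃≤n → begin
      seq α n + η        ≤⟨ +-monoˡ-≤ η (<⇒≤ (∣p-q∣<ε⇒p<q+ε (seq α n) p (close n N₃ N₃≤n ℕₚ.≤-refl))) ⟩
      p + η + η          ≤⟨ p≤p+q (p + η + η) (<⇒≤ 0<η) ⟩
      p + η + η + η      ≡⟨ x+e+e+e≡x+[e+e+e] p η ⟩
      p + (η + η + η)    ≤⟨ <⇒≤ u<0 ⟩
      0ℚ                 ∎)

  -- The limit superior of a bounded rational sequence.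

  module _ (em : ExcludedMiddle 0ℓ) where

    ∃-greatest : ∀ (P : ℕ → Set) {n} → P n → ∀ b → (∀ m → P m → m ℕ.≤ b) →
      ∃ λ m → P m × (∀ n → P n → n ℕ.≤ m)
    ∃-greatest P {n} Pn zero    bound = zero , subst P (ℕₚ.n≤0⇒n≡0 (bound n Pn)) Pn , bound
    ∃-greatest P     Pn (suc b) bound with em {P (suc b)}
    ... | yes Pb = suc b , Pb , bound
    ... | no ¬Pb = ∃-greatest P Pn b λ m Pm →
      ℕₚ.≤-pred (ℕₚ.≤∧≢⇒< (bound m Pm) λ { refl → ¬Pb Pm })

    ¬∀⇒∃¬ : ∀ {A : Set} {P : A → Set} → ¬ (∀ x → P x) → ∃ λ x → ¬ P x
    ¬∀⇒∃¬ {A} {P} ¬∀ = decidable-stable em λ ¬∃ → ¬∀ λ x → decidable-stable em λ ¬Px → ¬∃ (x , ¬Px)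

    InfinitelyOften : (ℕ → Set) → Set
    InfinitelyOften P = ∀ N → ∃ λ n → N ℕ.≤ n × P n

    module _ (a : ℕ → ℚ) (0≤a : ∀ n → 0ℚ ≤ a n) (N₁ : ℕ) (a≤1 : ∀ n → N₁ ℕ.≤ n → a n ≤ 1ℚ) where

      private
        Often : ℚ → Set
        Often q = InfinitelyOften (λ n → q ≤ a n)

        Often-mono : ∀ {p q} → p ≤ q → Often q → Often p
        Often-mono p≤q often N with n , N≤n , q≤ ← often N = n , N≤n , ≤-trans p≤q q≤

        ¬Often⇒< : ∀ {q} → ¬ Often q → ∃ λ N → ∀ n → N ℕ.≤ n → a n < q
        ¬Often⇒< ¬often with N , ¬∃ ← ¬∀⇒∃¬ ¬often =
          N , λ n N≤n → ≰⇒> λ q≤ → ¬∃ (n , N≤n , q≤)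

        often⇒≤1+j : ∀ j c → Often ((ℤ.+ c) / suc j) → c ℕ.≤ suc j
        often⇒≤1+j j c often with n , N₁≤n , c≤ ← often N₁ = ℕₚ.≮⇒≥ λ j<c →
          <-irrefl refl (<-≤-trans 1<
            (≤-trans (/-mono-≤ (suc (suc j)) j c j (ℕₚ.*-monoˡ-≤ (suc j) j<c)) (≤-trans c≤ (a≤1 n N₁≤n))))
          where
          1< : 1ℚ < (ℤ.+ suc (suc j)) / suc j
          1< = subst (1ℚ <_) (sym ([1+c]/d≡c/d+δ (suc j) j))
            (<-≤-trans (subst (_< 1ℚ + δ j) (+-identityʳ 1ℚ) (+-monoʳ-< 1ℚ 0<δ))
              (+-monoˡ-≤ (δ j) (/-mono-≤ 1 0 (suc j) j (ℕₚ.≤-reflexive (ℕₚ.*-comm 1 (suc j))))))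
            where
            0<δ : 0ℚ < δ j
            0<δ = positive⁻¹ (δ j) {{normalize-pos 1 (suc j)}}

        step : ℕ → ℕ → ℚ
        step j c = (ℤ.+ c) / suc j

        step-zero : ∀ j → Often (step j 0)
        step-zero j N = N , ℕₚ.≤-refl , ≤-trans (/-mono-≤ 0 j 0 0 z≤n) (0≤a N)

        step-suc : ∀ j c → step j c + δ j ≡ step j (suc c)
        step-suc j c = sym ([1+c]/d≡c/d+δ c j)

        abstract
          -- The greatest multiple of `δ j` that the sequence reaches infinitely often; it exists
          -- because 0 is always reached and the sequence is eventually at most 1. It approximates
          -- the limit superior from below to within `δ j`.
          threshold : ∀ j → ∃ λ q → Often q × ¬ Often (q + δ j)
          threshold j =
            let c , often , greatest = ∃-greatest (λ c → Often (step j c)) {0} (step-zero j) (suc j) (often⇒≤1+j j)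
            in step j c , often , λ often′ → ℕₚ.1+n≰n (greatest (suc c) (subst Often (step-suc j c) often′))

        x : ℕ → ℚ
        x j = proj₁ (threshold j)

        x-often : ∀ j → Often (x j)
        x-often j = proj₁ (proj₂ (threshold j))

        often⇒<x+δ : ∀ {q} → Often q → ∀ j → q < x j + δ j
        often⇒<x+δ often j = ≰⇒> λ x+δ≤q → proj₂ (proj₂ (threshold j)) (Often-mono x+δ≤q often)

        -- A level reached infinitely often, `x i`, lies below one that is not, `x j + δ j`. Used in
        -- both orders, this gives the Cauchy property.
        x-close : ∀ {ε J} → δ J ≤ ε → ∀ i j → J ℕ.≤ j → x i < x j + ε
        x-close δ≤ε i j J≤j = <-≤-trans (often⇒<x+δ (x-often i) j)
          (+-monoʳ-≤ (x j) (≤-trans (δ-anti-mono J≤j) δ≤ε))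

      limsup : ℝ
      limsup = mkℝ x λ ε 0<ε → let J , δ≤ε = archimedean 0<ε in
        J , λ m n J≤m J≤n → ∣p-q∣<ε (x m) (x n) (x-close δ≤ε m n J≤n) (x-close δ≤ε n m J≤m)

      limsup-isLimsup : IsLimsup a limsup
      limsup-isLimsup ε 0<ε with η , 0<η , 8η≡ε ← ∃-eighth 0<ε with J , δ≤η ← archimedean 0<η =
        (let N , a< = ¬Often⇒< (proj₂ (proj₂ (threshold J))) in
         N , λ n N≤n → η , 0<η , J , λ j J≤j → begin
          a n + η                ≤⟨ +-monoˡ-≤ η (<⇒≤ (a< n N≤n)) ⟩
          x J + δ J + η          ≤⟨ +-monoˡ-≤ η (+-mono-≤ (<⇒≤ (x-close δ≤η J j J≤j)) δ≤η) ⟩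
          x j + η + η + η        ≡⟨ x+e+e+e≡x+[e+e+e] (x j) η ⟩
          x j + (η + η + η)      ≤⟨ +-monoʳ-≤ (x j) 3η≤ε ⟩
          x j + ε                ∎) ,
        λ N → let n , N≤n , x≤a = x-often J N in
         n , N≤n , η , 0<η , 0 , λ j _ → begin
          x j + η                ≤⟨ +-monoˡ-≤ η (<⇒≤ (x-close δ≤η j J ℕₚ.≤-refl)) ⟩
          x J + η + η            ≤⟨ +-monoˡ-≤ η (+-monoˡ-≤ η x≤a) ⟩
          a n + η + η            ≤⟨ p≤p+q (a n + η + η) 0≤η ⟩
          a n + η + η + η        ≡⟨ x+e+e+e≡x+[e+e+e] (a n) η ⟩
          a n + (η + η + η)      ≤⟨ +-monoʳ-≤ (a n) 3η≤ε ⟩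
          a n + ε                ∎
        where
        open ≤-Reasoning
        0≤η = <⇒≤ 0<η
        3η≤ε : η + η + η ≤ ε
        3η≤ε = subst (η + η + η ≤_) (trans (regroup η) 8η≡ε)
          (p≤p+q (η + η + η) (+-mono-≤ (+-mono-≤ (+-mono-≤ (+-mono-≤ 0≤η 0≤η) 0≤η) 0≤η) 0≤η))
          where
          regroup : ∀ e → e + e + e + (e + e + e + e + e) ≡ e + e + e + e + e + e + e + e
          regroup = solve 1 (λ e → e :+ e :+ e :+ (e :+ e :+ e :+ e :+ e)
            := e :+ e :+ e :+ e :+ e :+ e :+ e :+ e) refl

      <limsup+ε : ∀ {q} → InfinitelyOften (λ n → q ≤ a n) → ∀ {ε} → 0ℚ < ε →
        ∃ λ N → ∀ n → N ℕ.≤ n → q < seq limsup n + ε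
      <limsup+ε often 0<ε with J , δ≤ε ← archimedean 0<ε = J , λ j J≤j →
        <-≤-trans (often⇒<x+δ often j) (+-monoʳ-≤ (x j) (≤-trans (δ-anti-mono J≤j) δ≤ε))

      limsup≤ : ∀ {q N} → (∀ n → N ℕ.≤ n → a n ≤ q) → ∀ j → seq limsup j ≤ q
      limsup≤ {N = N} a≤q j with n , N≤n , x≤a ← x-often j N = ≤-trans x≤a (a≤q n N≤n)

open import Data.Bool.Properties using (T?)
open import Data.Fin using (quotient)
open import Data.Fin.Subset using (_∪_)
open import Data.Integer as ℤ using ()
import Data.Integer.Properties as ℤₚ
open import Data.List as List using (length)
open import Data.List.Extrema.Nat using (min≤⊤)
open import Data.List.Properties using (length-filter)
open import Data.Nat hiding (∣_-_∣)
open import Data.Nat.Combinatorics using (_C_; nCn≡1)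
open import Data.Nat.Properties
open import Data.Nat.Tactic.RingSolver using (solve-∀)
open import Data.Rational as ℚ using (ℚ; mkℚ; 0ℚ; 1ℚ; *<*; *≤*)
import Data.Rational.Properties as ℚₚ
open Combinatorics
open Limsup hiding (δ) renaming (+-cancelʳ-≤ to ℚ+-cancelʳ-≤)

-- Consecutive `r`-th powers between two given fractions.

[y+s]^r*M≤ : ∀ r y s {M} → y + s ≤ M → (y + s) ^ r * M ≤ y ^ r * M + r * s * M ^ r
[y+s]^r*M≤ zero    y s {M} y+s≤M = m≤m+n (1 * M) 0
[y+s]^r*M≤ (suc r) y s {M} y+s≤M = begin
  (y + s) * (y + s) ^ r * M
    ≡⟨ *-assoc (y + s) ((y + s) ^ r) M ⟩
  (y + s) * ((y + s) ^ r * M)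
    ≤⟨ *-monoʳ-≤ (y + s) ([y+s]^r*M≤ r y s y+s≤M) ⟩
  (y + s) * (y ^ r * M + r * s * M ^ r)
    ≡⟨ expand y s r M (y ^ r) (M ^ r) ⟩
  y * y ^ r * M + (s * (y ^ r * M) + (y + s) * (r * s * M ^ r))
    ≤⟨ +-monoʳ-≤ (y * y ^ r * M) (+-mono-≤
         (*-monoʳ-≤ s (*-monoˡ-≤ M (^-monoˡ-≤ r (m+n≤o⇒m≤o y y+s≤M))))
         (*-monoˡ-≤ (r * s * M ^ r) y+s≤M)) ⟩
  y * y ^ r * M + (s * (M ^ r * M) + M * (r * s * M ^ r))
    ≡⟨ cong (y * y ^ r * M +_) (collect s r M (M ^ r)) ⟩
  y * y ^ r * M + suc r * s * (M * M ^ r) ∎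
  where
  open ≤-Reasoning
  expand : ∀ y s r M p q → (y + s) * (p * M + r * s * q) ≡ y * p * M + (s * (p * M) + (y + s) * (r * s * q))
  expand = solve-∀
  collect : ∀ s r M q → s * (q * M) + M * (r * s * q) ≡ suc r * s * (M * q)
  collect = solve-∀

∃-least : ∀ {P : ℕ → Set} → (∀ n → Dec (P n)) → ∀ n → P n →
  ∃ λ m → m ≤ n × P m × (∀ i → m ≡ suc i → ¬ P i)
∃-least P? zero    P0 = zero , z≤n , P0 , λ _ ()
∃-least P? (suc n) Pn with P? n
... | no ¬Pn = suc n , ≤-refl , Pn , λ { i refl → ¬Pn }
... | yes P  with m , m≤n , Pm , least ← ∃-least P? n P = m , m≤n⇒m≤1+n m≤n , Pm , least

-- Take `j` least with `U / D ≤ (j / M) ^ r`. Then `j - 1` is still below, and two steps of length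
-- `1 / M` raise the power by at most `2r / M = 1 / D`, which does not exceed `(W - U) / D`.
power-gap : ∀ r {U W D} → 0 < r → U < W → W ≤ D →
  ∃ λ M → ∃ λ j → j < M × U * M ^ r ≤ D * j ^ r × D * suc j ^ r ≤ W * M ^ r
power-gap r {U} {W} {D} 0<r U<W W≤D = M , j , j<M , U≤ , *-cancelʳ-≤ _ _ M upper
  where
  open ≤-Reasoning
  instance
    r≢0 : NonZero r
    r≢0 = >-nonZero 0<r
    D≢0 : NonZero D
    D≢0 = >-nonZero (<-≤-trans (≤-<-trans z≤n U<W) W≤D)
    2r≢0 : NonZero (2 * r)
    2r≢0 = m*n≢0 2 r
    M≢0 : NonZero (2 * r * D)
    M≢0 = m*n≢0 (2 * r) D

  M : ℕ
  M = 2 * r * D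

  increment : ∀ y s → s ≤ 2 → y + s ≤ M → D * (y + s) ^ r * M ≤ D * y ^ r * M + M * M ^ r
  increment y s s≤2 y+s≤M = begin
    D * (y + s) ^ r * M                        ≡⟨ *-assoc D _ M ⟩
    D * ((y + s) ^ r * M)                      ≤⟨ *-monoʳ-≤ D ([y+s]^r*M≤ r y s y+s≤M) ⟩
    D * (y ^ r * M + r * s * M ^ r)            ≡⟨ expand D (y ^ r) M r s (M ^ r) ⟩
    D * y ^ r * M + s * r * D * M ^ r          ≤⟨ +-monoʳ-≤ (D * y ^ r * M)
                                                    (*-monoˡ-≤ (M ^ r) (*-monoˡ-≤ D (*-monoˡ-≤ r s≤2))) ⟩
    D * y ^ r * M + M * M ^ r                  ∎
    where
    expand : ∀ D p M r s q → D * (p * M + r * s * q) ≡ D * p * M + s * r * D * q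
    expand = solve-∀

  1+predM≡M : suc (pred M) ≡ M
  1+predM≡M = suc-pred M

  -- This bounds the search and yields `j < M`: one step down from 1 loses at most `1 / D`, and
  -- `U + 1 ≤ D`.
  top : U * M ^ r ≤ D * pred M ^ r
  top = *-cancelʳ-≤ _ _ M (+-cancelʳ-≤ (M * M ^ r) _ _ (begin
    U * M ^ r * M + M * M ^ r              ≡⟨ collect U (M ^ r) M ⟩
    suc U * M ^ r * M                      ≤⟨ *-monoˡ-≤ M (*-monoˡ-≤ (M ^ r) (≤-trans U<W W≤D)) ⟩
    D * M ^ r * M                          ≡⟨ cong (λ x → D * x ^ r * M) (sym pred+1≡M) ⟩
    D * (pred M + 1) ^ r * M               ≤⟨ increment (pred M) 1 (s≤s z≤n) (≤-reflexive pred+1≡M) ⟩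
    D * pred M ^ r * M + M * M ^ r         ∎))
    where
    pred+1≡M : pred M + 1 ≡ M
    pred+1≡M = trans (+-comm (pred M) 1) 1+predM≡M
    collect : ∀ u q m → u * q * m + m * q ≡ suc u * q * m
    collect = solve-∀

  found : ∃ λ j → j ≤ pred M × U * M ^ r ≤ D * j ^ r × (∀ i → j ≡ suc i → ¬ (U * M ^ r ≤ D * i ^ r))
  found = ∃-least (λ j → U * M ^ r ≤? D * j ^ r) (pred M) top

  j : ℕ
  j = proj₁ found

  j<M : j < M
  j<M = ≤-trans (s≤s (proj₁ (proj₂ found))) (≤-reflexive 1+predM≡M)

  U≤ : U * M ^ r ≤ D * j ^ r
  U≤ = proj₁ (proj₂ (proj₂ found))

  base : ∀ i s → s ≤ 2 → i + s ≤ M → D * i ^ r ≤ U * M ^ r → D * (i + s) ^ r * M ≤ W * M ^ r * M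
  base i s s≤2 i+s≤M ≤U = begin
    D * (i + s) ^ r * M             ≤⟨ increment i s s≤2 i+s≤M ⟩
    D * i ^ r * M + M * M ^ r       ≤⟨ +-monoˡ-≤ (M * M ^ r) (*-monoˡ-≤ M ≤U) ⟩
    U * M ^ r * M + M * M ^ r       ≡⟨ collect U (M ^ r) M ⟩
    suc U * M ^ r * M               ≤⟨ *-monoˡ-≤ M (*-monoˡ-≤ (M ^ r) U<W) ⟩
    W * M ^ r * M                   ∎
    where
    collect : ∀ u q m → u * q * m + m * q ≡ suc u * q * m
    collect = solve-∀

  upper : D * suc j ^ r * M ≤ W * M ^ r * M
  upper = at j refl
    where
    0^r≡0 : ∀ r → .{{NonZero r}} → 0 ^ r ≡ 0
    0^r≡0 (suc r) = refl
    at : ∀ i → j ≡ i → D * suc i ^ r * M ≤ W * M ^ r * M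
    -- Here `j` has no predecessor, and a single step up from `0 ^ r = 0` suffices; this uses
    -- `r > 0`.
    at zero    j≡0  = base 0 1 (s≤s z≤n) (≤-trans (s≤s z≤n) j<M)
      (≤-trans (≤-reflexive (trans (cong (D *_) (0^r≡0 r)) (*-zeroʳ D))) z≤n)
    at (suc i) j≡1+i = subst (λ x → D * x ^ r * M ≤ W * M ^ r * M) (+-comm i 2)
      (base i 2 ≤-refl
        (≤-trans (≤-reflexive (+-comm i 2)) (subst (_< M) j≡1+i j<M))
        (<⇒≤ (≰⇒> (proj₂ (proj₂ (proj₂ found)) i j≡1+i))))

common-denominator : ∀ {u w} → 0ℚ ℚ.≤ u → u ℚ.< w → w ℚ.≤ 1ℚ →
  ∃ λ U → ∃ λ W → ∃ λ d → U < W × W ≤ suc d ×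
    u ℚ.≤ (ℤ.+ U) ℚ./ suc d × (ℤ.+ W) ℚ./ suc d ℚ.≤ w
common-denominator {mkℚ ℤ.-[1+ _ ] _ _} (*≤* ())
common-denominator {mkℚ (ℤ.+ a) b p} {mkℚ ℤ.-[1+ _ ] e q} _ (*<* u<w)
  with subst (ℤ._< _) (sym (ℤₚ.pos-* a (suc e))) u<w
... | ()
common-denominator {mkℚ (ℤ.+ a) b p} {mkℚ (ℤ.+ c) e q} _ (*<* u<w) (*≤* w≤1) =
  -- The denominator `suc (e + b * suc e)` is `suc b * suc e` unfolded.
  a * suc e , c * suc b , e + b * suc e ,
  ℤₚ.drop‿+<+ (subst₂ ℤ._<_ (sym (ℤₚ.pos-* a (suc e))) (sym (ℤₚ.pos-* c (suc b))) u<w) ,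
  ≤-trans (*-monoˡ-≤ (suc b) c≤1+e) (≤-reflexive (*-comm (suc e) (suc b))) ,
  subst (ℚ._≤ (ℤ.+ (a * suc e)) ℚ./ suc (e + b * suc e)) (ℚₚ.↥p/↧p≡p (mkℚ (ℤ.+ a) b p))
    (/-mono-≤ a b (a * suc e) (e + b * suc e) (≤-reflexive (regroup a (suc b) (suc e)))) ,
  subst ((ℤ.+ (c * suc b)) ℚ./ suc (e + b * suc e) ℚ.≤_) (ℚₚ.↥p/↧p≡p (mkℚ (ℤ.+ c) e q))
    (/-mono-≤ (c * suc b) (e + b * suc e) c e (≤-reflexive (*-assoc c (suc b) (suc e))))
  where
  regroup : ∀ a b e → a * (b * e) ≡ a * e * b
  regroup = solve-∀
  c≤1+e : c ≤ suc e
  c≤1+e = subst₂ _≤_ (*-identityʳ c) (*-identityˡ (suc e))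
    (ℤₚ.drop‿+≤+ (subst₂ ℤ._≤_ (sym (ℤₚ.pos-* c 1)) (sym (ℤₚ.pos-* 1 (suc e))) w≤1))

-- Ratios, and existence of the extremal numbers.

ratio-≤ : ∀ e c W d → e * suc d ≤ W * c → ratio e c ℚ.≤ (ℤ.+ W) ℚ./ suc d
ratio-≤ e zero    W d _    = /-mono-≤ 0 0 W d z≤n
ratio-≤ e (suc c) W d ed≤Wc = /-mono-≤ e c W d ed≤Wc

≤-ratio : ∀ U d e c → 0 < c → U * c ≤ e * suc d → (ℤ.+ U) ℚ./ suc d ℚ.≤ ratio e c
≤-ratio U d e (suc c) _ Uc≤ed = /-mono-≤ U d e c Uc≤ed

0≤ratio : ∀ e c → 0ℚ ℚ.≤ ratio e c
0≤ratio e zero    = ℚₚ.≤-refl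
0≤ratio e (suc c) = /-mono-≤ 0 0 e c z≤n

-- At `q = k`, `qCk*n^k≤nCk*q^k` bounds the positive number `n ^ k` by a multiple of `n C k`.
0<nCk : ∀ {n k} → 0 < n → k ≤ n → 0 < n C k
0<nCk {n} {k} 0<n k≤n with n C k | qCk*n^k≤nCk*q^k k≤n k
... | suc _ | _ = z<s
... | zero  | le = contradiction (≤-trans (m^n>0 n {{>-nonZero 0<n}} k)
  (≤-trans (≤-reflexive (sym (trans (cong (_* n ^ k) (nCn≡1 k)) (*-identityˡ _)))) le)) λ ()

-- A crude bound that lets `IsEx-exists` pick a greatest value.
minDegree-bound : ∀ {k n} ℓ (H : KGraph k n) → minDegree ℓ H ≤ length (subsetsOfSize n (k ∸ ℓ))
minDegree-bound {k} {n} ℓ H with subsetsOfSize n ℓ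
... | List.[]     = z≤n
... | U List.∷ Us = ≤-trans (min≤⊤ (degree ℓ H U) (List.map (degree ℓ H) Us))
  (length-filter (T? ∘ λ S → edge H (S ∪ U)) (subsetsOfSize n (k ∸ ℓ)))

IsEx-exists : ExcludedMiddle 0ℓ → ∀ {k} ℓ (ℱ : Family k) n → ∃ (IsEx ℓ ℱ n)
IsEx-exists em {k} ℓ ℱ n with em {∃ λ (H : KGraph k n) → Free ℱ H}
... | no none = 0 , inj₂ ((λ H free → none (H , free)) , refl)
... | yes (H , free)
  with e , attained , greatest ← ∃-greatest em (λ d → ∃ λ (H : KGraph k n) → Free ℱ H × minDegree ℓ H ≡ d)
         (H , free , refl) (length (subsetsOfSize n (k ∸ ℓ))) (λ { _ (H , _ , refl) → minDegree-bound ℓ H }) =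
  e , inj₁ (attained , λ H free → greatest _ (H , free , refl))

-- Choice of the parameters, and bounds on the resulting density.

module _ (em : ExcludedMiddle 0ℓ) {k ℓ : ℕ} (ℓ<k : ℓ < k) (1<ℓ : 1 < ℓ) where

  private
    r : ℕ
    r = k ∸ ℓ

    r+ℓ≡k : r + ℓ ≡ k
    r+ℓ≡k = m∸n+n≡m (<⇒≤ ℓ<k)

  HasDensityIn : ℚ → ℚ → Set₁
  HasDensityIn u w = Σ (Family k) λ ℱ → ∃ λ x → IsTuranDensity ℓ ℱ x × (∀ n → seq x n ℚ.≤ w) ×
    (∀ {ε} → 0ℚ ℚ.< ε → ∃ λ N → ∀ n → N ≤ n → u ℚ.< seq x n ℚ.+ ε)

  module Forbid (U W d M j : ℕ) (W≤D : W ≤ suc d) (j<M : j < M)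
    (U≤ : U * M ^ r ≤ suc d * j ^ r) (≤W : suc d * suc j ^ r ≤ W * M ^ r) where

    private
      -- All errors fit into one block of `k` sites. The `r` labels lost in the greedy count leave
      -- `j * k` out of `M * k`; the `ℓ` labels avoided bring `a` up to `suc j * k`, at most `m`;
      -- and `suc a` is still at most `suc j * k`.
      m a : ℕ
      m = M * k
      a = j * k + r

      a+ℓ≡[1+j]*k : a + ℓ ≡ suc j * k
      a+ℓ≡[1+j]*k = trans (+-assoc (j * k) r ℓ) (trans (cong (j * k +_) r+ℓ≡k) (+-comm (j * k) k))

      a+ℓ≤m : a + ℓ ≤ m
      a+ℓ≤m = ≤-trans (≤-reflexive a+ℓ≡[1+j]*k) (*-monoˡ-≤ k j<M)

      1+a≤[1+j]*k : suc a ≤ suc j * k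
      1+a≤[1+j]*k = ≤-trans (≤-reflexive (+-comm 1 a))
        (≤-trans (+-monoʳ-≤ a (<⇒≤ 1<ℓ)) (≤-reflexive a+ℓ≡[1+j]*k))

      0<m : 0 < m
      0<m = <-≤-trans (≤-<-trans z≤n 1<ℓ) (≤-trans (m≤n+m ℓ a) a+ℓ≤m)

    open Construction em k ℓ m a 1<ℓ (<⇒≤ ℓ<k) a+ℓ≤m

    ℱ : Family k
    ℱ = Dense ℓ (m * (m * ℓ)) (suc a) m

    ex : ℕ → ℕ
    ex n = proj₁ (IsEx-exists em ℓ ℱ n)

    ex-isEx : ∀ n → IsEx ℓ ℱ n (ex n)
    ex-isEx n = proj₂ (IsEx-exists em ℓ ℱ n)

    density : ℕ → ℚ
    density n = ratio (ex n) (n C r)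

    ex-upper : ∀ n → m * (m * ℓ) < n → m ^ r * ex n ≤ suc a ^ r * (n C r)
    ex-upper n n-large with ex-isEx n
    ... | inj₂ (_ , ex≡0) = ≤-trans (≤-reflexive (trans (cong (m ^ r *_) ex≡0) (*-zeroʳ (m ^ r)))) z≤n
    ... | inj₁ ((H , free , δ≡ex) , _) = subst (λ e → m ^ r * e ≤ suc a ^ r * (n C r)) δ≡ex
      (≮⇒≥ λ dense → free n H (n-large , dense) (Contains-refl H))

    ex-lower : ∀ t → ℓ ≤ m * t → (t * (j * k)) ^ r ≤ ex (m * t) * r !
    ex-lower t ℓ≤n with ex-isEx (m * t)
    ... | inj₂ (none , _) = contradiction (cyclicGraph-free {lab = quotient {m} t}) (none (cyclicGraph (quotient {m} t)))
    ... | inj₁ (_ , greatest) = ≤-trans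
      -- Labelling by `quotient` puts `t` vertices at each site; with `c = j * k`, the sum `c + r`
      -- is `a`.
      (minDegree-cyclicGraph (sum-quotient m t) ≤-refl ℓ≤n)
      (*-monoˡ-≤ (r !) (greatest (cyclicGraph (quotient {m} t)) cyclicGraph-free))

    density-upper : ∀ n → suc (m * (m * ℓ)) ≤ n → density n ℚ.≤ (ℤ.+ W) ℚ./ suc d
    density-upper n n-large = ratio-≤ (ex n) (n C r) W d
      (*-cancelˡ-≤ (m ^ r) {{m^n≢0 m r {{>-nonZero 0<m}}}} (begin
        m ^ r * (ex n * suc d)               ≡⟨ regroup (m ^ r) (ex n) (suc d) ⟩
        suc d * (m ^ r * ex n)               ≤⟨ *-monoʳ-≤ (suc d) (ex-upper n n-large) ⟩
        suc d * (suc a ^ r * (n C r))        ≤⟨ *-monoʳ-≤ (suc d) (*-monoˡ-≤ (n C r) (^-monoˡ-≤ r 1+a≤[1+j]*k)) ⟩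
        suc d * ((suc j * k) ^ r * (n C r))  ≡⟨ cong (λ x → suc d * (x * (n C r))) (^-distribʳ-* r (suc j) k) ⟩
        suc d * (suc j ^ r * k ^ r * (n C r)) ≡⟨ regroup′ (suc d) (suc j ^ r) (k ^ r) (n C r) ⟩
        suc d * suc j ^ r * (k ^ r * (n C r)) ≤⟨ *-monoˡ-≤ (k ^ r * (n C r)) ≤W ⟩
        W * M ^ r * (k ^ r * (n C r))        ≡⟨ regroup″ W (M ^ r) (k ^ r) (n C r) ⟩
        M ^ r * k ^ r * (W * (n C r))        ≡⟨ cong (_* (W * (n C r))) (sym (^-distribʳ-* r M k)) ⟩
        m ^ r * (W * (n C r))                ∎))
      where
      open ≤-Reasoning
      regroup : ∀ x y z → x * (y * z) ≡ z * (x * y)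
      regroup = solve-∀
      regroup′ : ∀ a b c d → a * (b * c * d) ≡ a * b * (c * d)
      regroup′ = solve-∀
      regroup″ : ∀ a b c d → a * b * (c * d) ≡ b * c * (a * d)
      regroup″ = solve-∀

    -- A limit superior asks for infinitely many orders only, so multiples of `m`, where the sites
    -- can be filled evenly, are enough.
    density-lower : InfinitelyOften em (λ n → (ℤ.+ U) ℚ./ suc d ℚ.≤ density n)
    density-lower N = m * t , N≤n , ≤-ratio U d (ex (m * t)) (m * t C r)
      (0<nCk (≤-trans 0<m m≤n) (≤-trans (m≤n+m r (j * k)) (≤-trans (m≤m+n a ℓ) (≤-trans a+ℓ≤m m≤n))))
      (*-cancelʳ-≤ _ _ (r !) {{r !≢0}} (begin
        U * (m * t C r) * r !           ≡⟨ *-assoc U (m * t C r) (r !) ⟩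
        U * ((m * t C r) * r !)         ≤⟨ *-monoʳ-≤ U (nCk*k!≤n^k (m * t) r) ⟩
        U * (M * k * t) ^ r             ≡⟨ cong (U *_) (trans (cong (_^ r) (*-assoc M k t)) (^-distribʳ-* r M (k * t))) ⟩
        U * (M ^ r * (k * t) ^ r)       ≡⟨ sym (*-assoc U (M ^ r) _) ⟩
        U * M ^ r * (k * t) ^ r         ≤⟨ *-monoˡ-≤ ((k * t) ^ r) U≤ ⟩
        suc d * j ^ r * (k * t) ^ r     ≡⟨ *-assoc (suc d) (j ^ r) _ ⟩
        suc d * (j ^ r * (k * t) ^ r)   ≡⟨ cong (suc d *_) (trans (sym (^-distribʳ-* r j (k * t))) (cong (_^ r) (regroup j k t))) ⟩
        suc d * (t * (j * k)) ^ r       ≤⟨ *-monoʳ-≤ (suc d) (ex-lower t (≤-trans (m≤n+m ℓ a) (≤-trans a+ℓ≤m m≤n))) ⟩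
        suc d * (ex (m * t) * r !)      ≡⟨ regroup′ (suc d) (ex (m * t)) (r !) ⟩
        ex (m * t) * suc d * r !        ∎))
      where
      open ≤-Reasoning
      t : ℕ
      t = suc N
      m≤n : m ≤ m * t
      m≤n = m≤m*n m t
      N≤n : N ≤ m * t
      N≤n = ≤-trans (n≤1+n N) (m≤n*m t m {{>-nonZero 0<m}})
      regroup : ∀ j k t → j * (k * t) ≡ t * (j * k)
      regroup = solve-∀
      regroup′ : ∀ a b c → a * (b * c) ≡ b * a * c
      regroup′ = solve-∀

    density≤1 : ∀ n → suc (m * (m * ℓ)) ≤ n → density n ℚ.≤ 1ℚ
    density≤1 n n-large = ℚₚ.≤-trans (density-upper n n-large)
      (/-mono-≤ W d 1 0 (≤-trans (≤-reflexive (*-identityʳ W)) (≤-trans W≤D (≤-reflexive (sym (*-identityˡ (suc d)))))))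

    0≤density : ∀ n → 0ℚ ℚ.≤ density n
    0≤density n = 0≤ratio (ex n) (n C r)

    π : ℝ
    π = limsup em density 0≤density (suc (m * (m * ℓ))) density≤1

    π-isTuranDensity : IsTuranDensity ℓ ℱ π
    π-isTuranDensity = ex , ex-isEx , limsup-isLimsup em density 0≤density (suc (m * (m * ℓ))) density≤1

    ∃-density : ∀ {u w} → u ℚ.≤ (ℤ.+ U) ℚ./ suc d → (ℤ.+ W) ℚ./ suc d ℚ.≤ w → HasDensityIn u w
    ∃-density {u} {w} u≤U/D W/D≤w = ℱ , π , π-isTuranDensity , upper , lower
      where
      upper : ∀ n → seq π n ℚ.≤ w
      upper n = ℚₚ.≤-trans
        (limsup≤ em density 0≤density (suc (m * (m * ℓ))) density≤1 density-upper n) W/D≤w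
      lower : ∀ {ε} → 0ℚ ℚ.< ε → ∃ λ N → ∀ n → N ≤ n → u ℚ.< seq π n ℚ.+ ε
      lower 0<ε =
        let N , U/D< = <limsup+ε em density 0≤density (suc (m * (m * ℓ))) density≤1 density-lower 0<ε
        in N , λ n N≤n → ℚₚ.≤-<-trans u≤U/D (U/D< n N≤n)

  hasDensityIn : ∀ {u w} → 0ℚ ℚ.≤ u → u ℚ.< w → w ℚ.≤ 1ℚ → HasDensityIn u w
  hasDensityIn 0≤u u<w w≤1 =
    let U , W , d , U<W , W≤D , u≤U/D , W/D≤w = common-denominator 0≤u u<w w≤1
        M , j , j<M , U≤ , ≤W = power-gap r (m<n⇒0<n∸m ℓ<k) U<W W≤D
    in Forbid.∃-density U W d M j W≤D j<M U≤ ≤W u≤U/D W/D≤w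

  -- The bound `x <ʳ 1ʳ` is kept because `α + ε` may exceed 1, while the density statement asks for
  -- a point of [0, 1).
  density-between : ∀ α → α ∈[0,1⟩ → ∀ ε → 0ʳ <ʳ ε →
    Σ (Family k) λ ℱ → ∃ λ x → IsTuranDensity ℓ ℱ x × α <ʳ x × x <ʳ α +ʳ ε × x <ʳ 1ʳ
  density-between α α∈ ε 0<ε = within (rational-gap α ε α∈ 0<ε)
    where
    within : RationalGap α ε →
      Σ (Family k) λ ℱ → ∃ λ x → IsTuranDensity ℓ ℱ x × α <ʳ x × x <ʳ α +ʳ ε × x <ʳ 1ʳ
    within (u , w , η , 0≤u , u<w , 0<η , w+η≤1 , N , gap) =
      squeeze (hasDensityIn 0≤u u<w (ℚₚ.≤-trans (p≤p+q w (ℚₚ.<⇒≤ 0<η)) w+η≤1))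
      where
      squeeze : HasDensityIn u w →
        Σ (Family k) λ ℱ → ∃ λ x → IsTuranDensity ℓ ℱ x × α <ʳ x × x <ʳ α +ʳ ε × x <ʳ 1ʳ
      squeeze (ℱ , x , isDensity , x≤w , u<x) =
        ℱ , x , isDensity ,
        (η , 0<η , N ⊔ N′ , λ n n≥ → ℚ+-cancelʳ-≤ η (ℚₚ.≤-trans
          (proj₁ (gap n (m⊔n≤o⇒m≤o N N′ n≥))) (ℚₚ.<⇒≤ (proj₂ (u<x 0<η) n (m⊔n≤o⇒n≤o N N′ n≥))))) ,
        (η , 0<η , N , λ n N≤n → ℚₚ.≤-trans (ℚₚ.+-monoˡ-≤ η (x≤w n)) (proj₂ (gap n N≤n))) ,
        (η , 0<η , 0 , λ n _ → ℚₚ.≤-trans (ℚₚ.+-monoˡ-≤ η (x≤w n)) w+η≤1)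
        where N′ = proj₁ (u<x 0<η)

-- Order of the reals, non-jumps and density in [0, 1).

0≤ʳ-<ʳ-trans : ∀ {x y} → 0ʳ ≤ʳ x → x <ʳ y → 0ʳ ≤ʳ y
0≤ʳ-<ʳ-trans {x} {y} 0≤x (ε , 0<ε , N , x<y) (ε′ , 0<ε′ , N′ , y<0) = 0≤x (ε , 0<ε , N ⊔ N′ , λ n n≥ →
  ℚₚ.≤-trans (x<y n (m⊔n≤o⇒m≤o N N′ n≥))
    (ℚₚ.≤-trans (p≤p+q (seq y n) (ℚₚ.<⇒≤ 0<ε′)) (y<0 n (m⊔n≤o⇒n≤o N N′ n≥))))

<ʳ⇒<ʳ+ʳ : ∀ {x y ε} → x <ʳ y → 0ʳ <ʳ ε → x <ʳ y +ʳ ε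
<ʳ⇒<ʳ+ʳ {x} {y} {ε} (η , 0<η , N , x<y) (ε′ , 0<ε′ , N′ , 0<ε) = η , 0<η , N ⊔ N′ , λ n n≥ →
  ℚₚ.≤-trans (x<y n (m⊔n≤o⇒m≤o N N′ n≥))
    (p≤p+q (seq y n) (ℚₚ.≤-trans (ℚₚ.<⇒≤ 0<ε′)
      (subst (ℚ._≤ seq ε n) (ℚₚ.+-identityˡ ε′) (0<ε n (m⊔n≤o⇒n≤o N N′ n≥)))))

theorem1p7 : ExcludedMiddle 0ℓ → ∀ (k ℓ : ℕ) → ℓ < k → 1 < ℓ →
    (∀ α → α ∈[0,1⟩ → ¬ IsJump k ℓ α) ×
    (∀ α → α ∈[0,1⟩ → ∀ δ → 0ʳ <ʳ δ →
    Σ (Family k) λ ℱ → ∃ λ x → IsTuranDensity ℓ ℱ x × α <ʳ x × x <ʳ α +ʳ δ) ×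
    DenseIn[0,1⟩ (Π k ℓ)
theorem1p7 em k ℓ ℓ<k 1<ℓ = notJump , between , dense
  where
  between : ∀ α → α ∈[0,1⟩ → ∀ δ → 0ʳ <ʳ δ →
    Σ (Family k) λ ℱ → ∃ λ x → IsTuranDensity ℓ ℱ x × α <ʳ x × x <ʳ α +ʳ δ
  between α α∈ δ 0<δ =
    let ℱ , x , isDensity , α<x , x<α+δ , _ = density-between em ℓ<k 1<ℓ α α∈ δ 0<δ
    in ℱ , x , isDensity , α<x , x<α+δ

  notJump : ∀ α → α ∈[0,1⟩ → ¬ IsJump k ℓ α
  notJump α α∈ (δ , 0<δ , jump) = let ℱ , found = between α α∈ δ 0<δ in jump ℱ found

  dense : DenseIn[0,1⟩ (Π k ℓ)
  dense x x∈ ε 0<ε =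
    let ℱ , y , isDensity , x<y , y<x+ε , y<1 = density-between em ℓ<k 1<ℓ x x∈ ε 0<ε
    in y , (ℱ , isDensity) , (0≤ʳ-<ʳ-trans {x} {y} (proj₁ x∈) x<y , y<1) ,
       <ʳ⇒<ʳ+ʳ {x} {y} {ε} x<y 0<ε , y<x+ε
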